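{- Let $F$ be a graph obtained from any forest with at most one isolated vertex by subdividing each edge at least once. Then $F$ admits an antimagic orientation.
   Context: All graphs are finite and simple, and digraphs are orientations of simple graphs. Let $D$ be a digraph with $m$ arcs and arc set $A(D)$. For a bijection $\tau:A(D)\to\{1,2,\ldots,m\}$ and a vertex $v$, the oriented vertex-sum $s_{(D,\tau)}(v)$ is the sum of the labels $\tau(e)$ over all arcs $e$ entering $v$ minus the sum of the labels $\tau(e)$ over all arcs $e$ leaving $v$. The bijection $\tau$ is an antimagic labeling of $D$ if $s_{(D,\tau)}(u)\neq s_{(D,\tau)}(v)$ for all distinct vertices $u,v$ of $D$. A graph $G$ admits an antimagic orientation if $G$ has an orientation $D$ such that $D$ has an antimagic labeling. An isolated vertex is a vertex of degree $0$. Subdividing each edge at least once means replacing each edge $uv$ by a path from $u$ to $v$ with at least one internal vertex, all internal vertices being new and distinct for distinct edges; the number of internal vertices may vary from edge to edge. -}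

module Defs where

open import Data.Bool.Base using (Bool; T)
open import Data.Bool.Properties using (T?)
open import Data.Fin.Base using (Fin; zero; suc; toℕ; inject₁; fromℕ; _<_)
open import Data.Fin.Subset using (Subset; ∣_∣)
open import Data.Integer.Base as ℤ using (ℤ; +_)
open import Data.Nat.Base as ℕ using (ℕ; suc; _+_)
open import Data.Nat.Properties using (+-0-commutativeMonoid)
open import Data.Product.Base using (Σ-syntax; ∃-syntax; _×_; _,_)
open import Data.Sum.Base using (_⊎_; inj₁; inj₂)
open import Data.Vec.Base using (tabulate)
open import Function.Bundles using (_⤖_; _⇔_; module Bijection)
open import Level using (0ℓ)
open import Relation.Binary.Construct.Closure.Symmetric using (SymClosure)
open import Relation.Binary.Core using (Rel)
open import Relation.Binary.Definitions using (Symmetric; Irreflexive; Asymmetric)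
open import Relation.Binary.PropositionalEquality.Core using (_≡_; _≢_)
open import Relation.Nullary.Decidable.Core using (yes; no)
open import Relation.Nullary.Negation.Core using (¬_)

open import Algebra.Properties.CommutativeMonoid.Sum +-0-commutativeMonoid
  using (sum)

record Graph (n : ℕ) : Set where
  field
    adjacent? : Fin n → Fin n → Bool

  Adj : Rel (Fin n) 0ℓ
  Adj u v = T (adjacent? u v)

  field
    symmetric   : Symmetric Adj
    irreflexive : Irreflexive _≡_ Adj

  neighbours : Fin n → Subset n
  neighbours v = tabulate (adjacent? v)

  degree : Fin n → ℕ
  degree v = ∣ neighbours v ∣

  Isolated : Fin n → Set
  Isolated v = degree v ≡ 0

  -- Each undirected edge occurs exactly once: its ends are listed in
  -- increasing order.
  record Edge : Set where
    constructor edge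
    field
      {low high} : Fin n
      low<high   : low < high
      adj        : Adj low high

  -- A cycle through 3 + excess distinct vertices.
  record Cycle : Set where
    field
      excess   : ℕ
      vertex   : Fin (3 + excess) → Fin n
      distinct : ∀ i j → vertex i ≡ vertex j → i ≡ j
      step     : ∀ (i : Fin (2 + excess)) →
                 Adj (vertex (inject₁ i)) (vertex (suc i))
      close    : Adj (vertex (fromℕ (2 + excess))) (vertex zero)

  Forest : Set
  Forest = ¬ Cycle

  AtMostOneIsolatedVertex : Set
  AtMostOneIsolatedVertex = ∀ u v → Isolated u → Isolated v → u ≡ v

module _ {n : ℕ} (H : Graph n) (internal : Graph.Edge H → ℕ) where

  open Graph H

  SubdivisionVertex : Set
  SubdivisionVertex = Fin n ⊎ (Σ[ e ∈ Edge ] Fin (internal e))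

  -- Consecutive vertices along the path replacing e, traversed from its low
  -- end to its high end.  This describes that path only when internal e is
  -- positive, as is required in FullSubdivision below.
  data Consecutive : Rel SubdivisionVertex 0ℓ where
    enter : ∀ (e : Edge) (i : Fin (internal e)) → toℕ i ≡ 0 →
            Consecutive (inj₁ (Edge.low e)) (inj₂ (e , i))
    along : ∀ (e : Edge) (i j : Fin (internal e)) → toℕ j ≡ suc (toℕ i) →
            Consecutive (inj₂ (e , i)) (inj₂ (e , j))
    leave : ∀ (e : Edge) (i : Fin (internal e)) → suc (toℕ i) ≡ internal e →
            Consecutive (inj₂ (e , i)) (inj₁ (Edge.high e))

-- F is obtained, up to the naming of vertices, from H by subdividing each edge
-- at least once.
record FullSubdivision {n k : ℕ} (H : Graph n) (F : Graph k) : Set where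
  open Graph
  field
    internal   : Edge H → ℕ
    internal≥1 : ∀ e → 1 ℕ.≤ internal e
    vertices   : Fin k ⤖ SubdivisionVertex H internal

  open Bijection vertices using (to)

  field
    adjacency  : ∀ x y →
                Adj F x y ⇔ SymClosure (Consecutive H internal) (to x) (to y)

-- An orientation of a simple graph has neither loops nor opposite arcs; both
-- are excluded by asymmetry.
record Digraph (n : ℕ) : Set where
  field
    arc? : Fin n → Fin n → Bool

  _⟶_ : Rel (Fin n) 0ℓ
  u ⟶ v = T (arc? u v)

  field
    asymmetric : Asymmetric _⟶_

  record Arc : Set where
    constructor arc
    field
      {source target} : Fin n
      isArc           : source ⟶ target

  -- The bijection forces m to be the number of arcs.
  Labeling : ℕ → Set
  Labeling m = Arc ⤖ Fin m

  module _ {m : ℕ} (τ : Labeling m) where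

    -- Fin m stands for {1,…,m} by shifting.
    label : Arc → ℕ
    label a = suc (toℕ (Bijection.to τ a))

    -- The label of the arc from u to v, or 0 if there is no such arc.
    weight : Fin n → Fin n → ℕ
    weight u v with T? (arc? u v)
    ... | yes u⟶v = label (arc u⟶v)
    ... | no  _   = 0

    vertexSum : Fin n → ℤ
    vertexSum v = + sum (λ u → weight u v) ℤ.- + sum (λ w → weight v w)

    Antimagic : Set
    Antimagic = ∀ u v → u ≢ v → vertexSum u ≢ vertexSum v

_IsOrientationOf_ : ∀ {n} → Digraph n → Graph n → Set
D IsOrientationOf G = ∀ u v → Adj u v ⇔ (u ⟶ v ⊎ v ⟶ u)
  where
  open Graph G
  open Digraph D

AdmitsAntimagicOrientation : ∀ {n} → Graph n → Set
AdmitsAntimagicOrientation {n} G =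
  Σ[ D ∈ Digraph n ] D IsOrientationOf G ×
  (∃[ m ] Σ[ τ ∈ Digraph.Labeling D m ] Digraph.Antimagic D τ)

{-# OPTIONS --safe #-}
module Submission where

-- Root every component of H and direct each edge of F between a vertex and its
-- parent.  Along the path replacing an edge of H, counted from its upper end,
-- the internal vertices are alternately of kind link, with both edges leaving,
-- and of kind below, with the edge to the parent entering.  The lower end of the
-- path is again a below vertex if there is an odd number of internal vertices;
-- otherwise it hangs from a below vertex and is of kind direct, its edge to the
-- parent entering too.  Hence a link has a negative sum, a below vertex with a
-- direct child c has sum (own label) - (label of c), and all other sums are
-- nonnegative.
--
-- The edge from v to its parent is labelled by the rank of v in a linear order
-- in which below precedes direct precedes link.  Links are ordered first by the
-- number of links below their parent, then as their parents; below vertices as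
-- their parents; direct vertices opposite to their parents.  So the sums of two
-- links differ because both labels of the later one are larger, and those of two
-- below vertices with direct children because one label is larger and the other
-- smaller; the latter sums are negative, but smaller in absolute value than any
-- label of a link.  Among the remaining vertices, let w come after v with
-- respect to the number of links below, and then to the order itself.  For some
-- t, the links below v have labels at most t, those below w have labels
-- exceeding t, and v itself has a label at most t.  If v has d links below it,
-- its sum is at most (d + 1) t, which is less than the sum of w if w has more
-- than d; if w also has d, then both parts of the sum are larger for w.

open import Defs
open import Data.Bool.Base using (Bool; T; true; false)
open import Data.Bool.Properties using (T?; T-irrelevant)
open import Data.Fin.Base as Fin
  using (Fin; zero; suc; toℕ; fromℕ<; opposite)
open import Data.Fin.Properties as Fin
  using (any?; toℕ<n; toℕ-injective; toℕ-fromℕ; toℕ-fromℕ<; toℕ-inject₁;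
         injective⇒≤; opposite-prop; opposite-involutive)
open import Data.Fin.Subset using (∣_∣)
open import Data.Integer.Base as ℤ using () renaming (+_ to pos)
import Data.Integer.Properties as ℤ
open import Data.List.Base using (List; length; filter; allFin)
open import Data.List.Membership.Propositional using (_∈_; lose)
open import Data.List.Membership.Propositional.Properties using (∈-filter⁺; ∈-allFin)
open import Data.List.Properties using (filter-notAll)
open import Data.Nat.Base
open import Data.Nat.Properties
open import Data.Product.Base using (∃-syntax; _×_; _,_; proj₁; proj₂; uncurry)
open import Data.Sum.Base using (_⊎_; inj₁; inj₂; [_,_]′; swap)
open import Data.Unit.Base using (tt)
open import Data.Vec.Base using (tabulate)
open import Function.Base using (_∘_)
open import Function.Bundles using (_⇔_; mk⇔; mk⤖; module Equivalence; module Bijection)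
open import Relation.Binary.Construct.Closure.Symmetric as Symmetric
  using (SymClosure; fwd; bwd)
open import Relation.Binary.Definitions using (DecidableEquality; tri<; tri≈; tri>)
open import Relation.Binary.PropositionalEquality
open import Relation.Nullary
open import Relation.Nullary.Decidable
  using (_×-dec_; _⊎-dec_; ⌊_⌋; toWitness; fromWitness; decidable-stable; map′)
open import Algebra.Properties.CommutativeMonoid.Sum +-0-commutativeMonoid
  using (sum; sum-cong-≗; ∑-distrib-+)

-- Finite sums of natural numbers

when : ∀ {P : Set} → Dec P → ℕ → ℕ
when (yes _) x = x
when (no _)  _ = 0

when-yes : ∀ {P : Set} (p? : Dec P) {x} → P → when p? x ≡ x
when-yes (yes _) _ = refl
when-yes (no ¬p) p = contradiction p ¬p

when-no : ∀ {P : Set} (p? : Dec P) {x} → ¬ P → when p? x ≡ 0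
when-no (yes p) ¬p = contradiction p ¬p
when-no (no _)  _  = refl

when-monoˡ : ∀ {P Q : Set} (p? : Dec P) (q? : Dec Q) {x} → (P → Q) →
             when p? x ≤ when q? x
when-monoˡ (yes p) q? P⇒Q = ≤-reflexive (sym (when-yes q? (P⇒Q p)))
when-monoˡ (no _)  q? P⇒Q = z≤n

sum-mono-≤ : ∀ {k} {f g : Fin k → ℕ} → (∀ i → f i ≤ g i) → sum f ≤ sum g
sum-mono-≤ {zero}  f≤g = z≤n
sum-mono-≤ {suc k} f≤g = +-mono-≤ (f≤g zero) (sum-mono-≤ (f≤g ∘ suc))

sum-mono-< : ∀ {k} {f g : Fin k → ℕ} → (∀ i → f i ≤ g i) →
             ∀ j → f j < g j → sum f < sum g
sum-mono-< f≤g zero    fj<gj = +-mono-<-≤ fj<gj (sum-mono-≤ (f≤g ∘ suc))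
sum-mono-< f≤g (suc j) fj<gj =
  +-mono-≤-< (f≤g zero) (sum-mono-< (f≤g ∘ suc) j fj<gj)

sum-zero : ∀ {k} {f : Fin k → ℕ} → (∀ i → f i ≡ 0) → sum f ≡ 0
sum-zero {zero}  f≡0 = refl
sum-zero {suc k} f≡0 = cong₂ _+_ (f≡0 zero) (sum-zero (f≡0 ∘ suc))

sum-single : ∀ {k} {f : Fin k → ℕ} j → (∀ i → i ≢ j → f i ≡ 0) → sum f ≡ f j
sum-single {f = f} zero elsewhere =
  trans (cong (f zero +_) (sum-zero (λ i → elsewhere (suc i) λ ())))
        (+-identityʳ (f zero))
sum-single {f = f} (suc j) elsewhere =
  trans (cong (_+ sum (f ∘ suc)) (elsewhere zero λ ()))
        (sum-single j (λ i i≢j → elsewhere (suc i) (i≢j ∘ Fin.suc-injective)))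

term≤sum : ∀ {k} (f : Fin k → ℕ) i → f i ≤ sum f
term≤sum f zero    = m≤m+n (f zero) _
term≤sum f (suc i) = ≤-trans (term≤sum (f ∘ suc) i) (m≤n+m _ (f zero))

sum-*ʳ : ∀ {k} (f : Fin k → ℕ) c → sum (λ i → f i * c) ≡ sum f * c
sum-*ʳ {zero}  f c = refl
sum-*ʳ {suc k} f c = trans (cong (f zero * c +_) (sum-*ʳ (f ∘ suc) c))
                           (sym (*-distribʳ-+ c (f zero) (sum (f ∘ suc))))

-- Ranking the elements of a decidable subset by an injective key

module Rank {k} {P : Fin k → Set} (P? : ∀ v → Dec (P v)) (key : Fin k → ℕ)
            (key-injective : ∀ {v w} → key v ≡ key w → v ≡ w) where

  before? : ∀ T v → Dec (P v × key v < T)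
  before? T v = P? v ×-dec (key v <? T)

  countBefore : ℕ → ℕ
  countBefore T = sum (λ v → when (before? T v) 1)

  total : ℕ
  total = sum (λ v → when (P? v) 1)

  rank : Fin k → ℕ
  rank v = countBefore (key v)

  countBefore-mono-≤ : ∀ {S T} → S ≤ T → countBefore S ≤ countBefore T
  countBefore-mono-≤ {S} {T} S≤T = sum-mono-≤ λ v →
    when-monoˡ (before? S v) (before? T v) λ (p , <S) → p , <-≤-trans <S S≤T

  countBefore-mono-< : ∀ {v S T} → P v → S ≤ key v → key v < T →
                       countBefore S < countBefore T
  countBefore-mono-< {v} {S} {T} p S≤ <T = sum-mono-<
    (λ u → when-monoˡ (before? S u) (before? T u)
             λ (q , <S) → q , <-trans (<-≤-trans <S S≤) <T)
    v (subst₂ _<_ (sym (when-no (before? S v) (λ (_ , <S) → <⇒≱ <S S≤)))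
                  (sym (when-yes (before? T v) (p , <T))) z<s)

  rank-mono-< : ∀ {v w} → P v → key v < key w → rank v < rank w
  rank-mono-< p v<w = countBefore-mono-< p ≤-refl v<w

  rank<total : ∀ {v} → P v → rank v < total
  rank<total {v} p = sum-mono-<
    (λ u → when-monoˡ (before? (key v) u) (P? u) proj₁)
    v (subst₂ _<_ (sym (when-no (before? (key v) v) (λ (_ , <v) → <-irrefl refl <v)))
                  (sym (when-yes (P? v) p)) z<s)

  rank-injective : ∀ {v w} → P v → P w → rank v ≡ rank w → v ≡ w
  rank-injective {v} {w} p q rv≡rw with <-cmp (key v) (key w)
  ... | tri< v<w _ _ = contradiction rv≡rw (<⇒≢ (rank-mono-< p v<w))
  ... | tri≈ _ v≡w _ = key-injective v≡w
  ... | tri> _ _ w<v = contradiction (sym rv≡rw) (<⇒≢ (rank-mono-< q w<v))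

  countBefore-suc-absent : ∀ {T} → ¬ (∃[ v ] P v × key v ≡ T) →
                           countBefore (suc T) ≤ countBefore T
  countBefore-suc-absent {T} absent = sum-mono-≤ λ v →
    when-monoˡ (before? (suc T) v) (before? T v) λ (p , <sT) →
      p , ≤∧≢⇒< (≤-pred <sT) (λ ≡T → absent (v , p , ≡T))

  countBefore-suc-present : ∀ v →
    countBefore (suc (key v)) ≤ suc (countBefore (key v))
  countBefore-suc-present v = begin
    countBefore (suc (key v))
      ≤⟨ sum-mono-≤ split ⟩
    sum (λ u → when (before? (key v) u) 1 + when (u Fin.≟ v) 1)
      ≡⟨ ∑-distrib-+ (λ u → when (before? (key v) u) 1) (λ u → when (u Fin.≟ v) 1) ⟩
    rank v + sum (λ u → when (u Fin.≟ v) 1)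
      ≡⟨ cong (rank v +_) (trans
           (sum-single v (λ u u≢v → when-no (u Fin.≟ v) u≢v))
           (when-yes (v Fin.≟ v) refl)) ⟩
    rank v + 1
      ≡⟨ +-comm (rank v) 1 ⟩
    suc (rank v) ∎
    where
    open ≤-Reasoning
    split : ∀ u → when (before? (suc (key v)) u) 1 ≤
                  when (before? (key v) u) 1 + when (u Fin.≟ v) 1
    split u with u Fin.≟ v
    ... | no u≢v  = ≤-trans
      (when-monoˡ (before? (suc (key v)) u) (before? (key v) u)
        λ (p , <sv) → p , ≤∧≢⇒< (≤-pred <sv) (u≢v ∘ key-injective))
      (m≤m+n _ 0)
    ... | yes _ with before? (suc (key v)) u
    ...   | yes _ = m≤n+m 1 _
    ...   | no _  = z≤n

  -- Raising the threshold by one raises `countBefore` by at most one, and only when it passes the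
  -- key of an element of `P`. So the threshold at which the count first exceeds `i` lies just past
  -- the key of an element of rank `i`.
  rank-surjective : ∀ {i} → i < total → ∃[ v ] P v × rank v ≡ i
  -- The threshold `suc (sum key)` is beyond every key, so its count is at least `total`.
  rank-surjective {i} i<total = search (suc (sum key))
    (<-≤-trans i<total (sum-mono-≤ λ v →
      when-monoˡ (P? v) (before? (suc (sum key)) v)
        λ p → p , s≤s (term≤sum key v)))
    where
    search : ∀ T → i < countBefore T → ∃[ v ] P v × rank v ≡ i
    search zero i< = contradiction
      (subst (i <_) (sum-zero λ v → when-no (before? 0 v) (λ ())) i<) λ ()
    search (suc T) i< with i <? countBefore T
    ... | yes i<T = search T i<T
    ... | no i≮T with any? (λ v → P? v ×-dec (key v ≟ T))
    ...   | no absent = contradiction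
              (<-≤-trans i< (countBefore-suc-absent absent)) i≮T
    ...   | yes (v , p , refl) = v , p ,
              ≤-antisym (≮⇒≥ i≮T) (≤-pred (≤-trans i< (countBefore-suc-present v)))

-- Rooted forests with typed vertices

data Kind : Set where
  root below direct link : Kind

-- Roots carry no label but are ordered as well, before everything else: links and their siblings
-- are compared through parents, which may be roots.
tier : Kind → ℕ
tier root   = 0
tier below  = 1
tier direct = 2
tier link   = 3

tier-injective : ∀ {c d} → tier c ≡ tier d → c ≡ d
tier-injective {root}   {root}   _ = refl
tier-injective {below}  {below}  _ = refl
tier-injective {direct} {direct} _ = refl
tier-injective {link}   {link}   _ = refl

tier≤3 : ∀ c → tier c ≤ 3
tier≤3 root   = z≤n
tier≤3 below  = s≤s z≤n
tier≤3 direct = s≤s (s≤s z≤n)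
tier≤3 link   = ≤-refl

_≟ᴷ_ : DecidableEquality Kind
c ≟ᴷ d = map′ tier-injective (cong tier) (tier c ≟ tier d)

-- parent and depth carry no information at a root.
record TypedForest (k : ℕ) : Set where
  field
    kind   : Fin k → Kind
    parent : Fin k → Fin k
    depth  : Fin k → ℕ

  Child : Fin k → Fin k → Set
  Child u v = kind u ≢ root × parent u ≡ v

  field
    depth-parent     : ∀ {v} → kind v ≢ root → depth (parent v) < depth v
    link-parent      : ∀ {v} → kind v ≡ link → kind (parent v) ≢ link
    -- As a below vertex is an only child, a link has exactly this one child.
    link-child       : ∀ {v} → kind v ≡ link → ∃[ c ] kind c ≡ below × parent c ≡ v
    below-parent     : ∀ {v} → kind v ≡ below → kind (parent v) ≡ link
    below-only-child : ∀ {u v} → kind v ≡ below → Child u (parent v) → u ≡ v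
    direct-parent    : ∀ {v} → kind v ≡ direct → kind (parent v) ≡ below
    direct-only-child : ∀ {u v} → kind v ≡ direct → Child u (parent v) → u ≡ v
    -- A childless root has vertex sum 0, so a second one would collide with it.
    one-childless-root : ∀ {r s} → kind r ≡ root → kind s ≡ root →
                         (∀ u → ¬ Child u r) → (∀ u → ¬ Child u s) → r ≡ s

module Order {k : ℕ} (S : TypedForest k) where

  open TypedForest S

  nonroot? : ∀ v → Dec (kind v ≢ root)
  nonroot? v = ¬? (kind v ≟ᴷ root)

  link⇒nonroot : ∀ {v} → kind v ≡ link → kind v ≢ root
  link⇒nonroot v-link v-root with () ← trans (sym v-link) v-root

  below⇒nonroot : ∀ {v} → kind v ≡ below → kind v ≢ root
  below⇒nonroot v-below v-root with () ← trans (sym v-below) v-root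

  direct⇒nonroot : ∀ {v} → kind v ≡ direct → kind v ≢ root
  direct⇒nonroot v-direct v-root with () ← trans (sym v-direct) v-root

  UpArc DownArc : Fin k → Fin k → Set
  UpArc   u v = kind u ≡ link × parent u ≡ v
  DownArc u v = (kind v ≢ root × kind v ≢ link) × parent v ≡ u

  upArc? : ∀ u v → Dec (UpArc u v)
  upArc? u v = (kind u ≟ᴷ link) ×-dec (parent u Fin.≟ v)

  lower? : ∀ v → Dec (kind v ≢ root × kind v ≢ link)
  lower? v = nonroot? v ×-dec ¬? (kind v ≟ᴷ link)

  downArc? : ∀ u v → Dec (DownArc u v)
  downArc? u v = lower? v ×-dec (parent v Fin.≟ u)

  linkDegree : Fin k → ℕ
  linkDegree v = sum (λ u → when (upArc? u v) 1)

  -- The order of the labels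

  -- One round of the recursive definition: `κ` orders the parents, `key` is the resulting order of
  -- all vertices.
  module Step (κ : Fin k → ℕ) where

    -- The summand `k` exceeds the offsets of roots, `suc (sum κ)` every value of `κ`. Hence tiers
    -- before `link` do not overlap; the offsets of links may be larger, but no tier follows.
    width : ℕ
    width = k + suc (sum κ)

    -- With the last digit `toℕ v` added in `offset`, this is a mixed-radix code of link degree, `κ`
    -- and index, ordered lexicographically: `width` bounds the middle digit, `k` the last.
    blockOffset : Fin k → ℕ
    blockOffset p = (linkDegree p * width + κ p) * k

    offset : Kind → Fin k → ℕ
    offset root   v = toℕ v
    offset below  v = κ (parent v)
    -- The subtraction reverses the order of the parents and is never truncated, by `κ<width`.
    offset direct v = width ∸ suc (κ (parent v))
    offset link   v = toℕ v + blockOffset (parent v)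

    key : Fin k → ℕ
    key v = tier (kind v) * width + offset (kind v) v

    κ<width : ∀ v → κ v < width
    κ<width v = ≤-trans (s≤s (term≤sum κ v)) (m≤n+m _ k)

    -- The intended meaning of key v < key w.
    data _≺_ (v w : Fin k) : Set where
      tiers    : tier (kind v) < tier (kind w) → v ≺ w
      roots    : kind v ≡ root → kind w ≡ root → toℕ v < toℕ w → v ≺ w
      belows   : kind v ≡ below → kind w ≡ below →
                 κ (parent v) < κ (parent w) → v ≺ w
      directs  : kind v ≡ direct → kind w ≡ direct →
                 κ (parent w) < κ (parent v) → v ≺ w
      degrees  : kind v ≡ link → kind w ≡ link →
                 linkDegree (parent v) < linkDegree (parent w) → v ≺ w
      blocks   : kind v ≡ link → kind w ≡ link →
                 linkDegree (parent v) ≡ linkDegree (parent w) →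
                 κ (parent v) < κ (parent w) → v ≺ w
      siblings : kind v ≡ link → kind w ≡ link → parent v ≡ parent w →
                 toℕ v < toℕ w → v ≺ w

    key-of : ∀ {v c} → kind v ≡ c → key v ≡ tier c * width + offset c v
    key-of refl = refl

    key<nextTier : ∀ {v} → kind v ≢ link → key v < suc (tier (kind v)) * width
    key<nextTier {v} ¬link = subst (key v <_) (+-comm (tier (kind v) * width) width)
      (+-monoʳ-< (tier (kind v) * width) (offset<width (kind v) ¬link))
      where
      offset<width : ∀ c → c ≢ link → offset c v < width
      offset<width root   _ = <-≤-trans (toℕ<n v) (m≤m+n k _)
      offset<width below  _ = κ<width (parent v)
      offset<width direct _ = subst (λ x → x ∸ suc (κ (parent v)) < x)
        (sym (+-suc k (sum κ))) (s≤s (m∸n≤m _ (κ (parent v))))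
      offset<width link ¬l = contradiction refl ¬l

    lexicographic-< : ∀ {d e a b} → a < width → d < e →
                      d * width + a < e * width + b
    lexicographic-< {d} {e} {a} {b} a< d<e = begin-strict
      d * width + a     <⟨ +-monoʳ-< (d * width) a< ⟩
      d * width + width ≡⟨ +-comm (d * width) width ⟩
      suc d * width     ≤⟨ *-monoˡ-≤ width d<e ⟩
      e * width         ≤⟨ m≤m+n (e * width) b ⟩
      e * width + b     ∎
      where open ≤-Reasoning

    -- The last digit `i` stays below its base `k`, so it causes no carry into the code of `p`.
    blockOffset-< : ∀ {p q} i →
      linkDegree p < linkDegree q ⊎ (linkDegree p ≡ linkDegree q × κ p < κ q) →
      toℕ {k} i + blockOffset p < blockOffset q
    blockOffset-< {p} {q} i p<q =
      ≤-trans (+-monoˡ-< (blockOffset p) (toℕ<n i)) (*-monoˡ-≤ k (code-< p<q))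
      where
      code-< : linkDegree p < linkDegree q ⊎ (linkDegree p ≡ linkDegree q × κ p < κ q) →
               linkDegree p * width + κ p < linkDegree q * width + κ q
      code-< (inj₁ d<) = lexicographic-< (κ<width p) d<
      code-< (inj₂ (d≡ , κ<)) =
        subst (λ d → linkDegree p * width + κ p < d * width + κ q) d≡
              (+-monoʳ-< (linkDegree p * width) κ<)

    same-kind : ∀ {v w c} → kind v ≡ c → kind w ≡ c → offset c v < offset c w →
                key v < key w
    same-kind {c = c} v-c w-c o< = subst₂ _<_ (sym (key-of v-c)) (sym (key-of w-c))
                                     (+-monoʳ-< (tier c * width) o<)

    tier<3⇒¬link : ∀ {c} {n} → tier c < n → n ≤ 3 → c ≢ link
    tier<3⇒¬link <n n≤3 refl = <⇒≱ <n n≤3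

    ≺⇒< : ∀ {v w} → v ≺ w → key v < key w
    ≺⇒< {v} {w} (tiers t<) = ≤-trans
      (key<nextTier (tier<3⇒¬link t< (tier≤3 (kind w))))
      (≤-trans (*-monoˡ-≤ width t<) (m≤m+n (tier (kind w) * width) _))
    ≺⇒< (roots v-r w-r v<w) = same-kind v-r w-r v<w
    ≺⇒< (belows v-b w-b p<q) = same-kind v-b w-b p<q
    ≺⇒< {v} {w} (directs v-d w-d q<p) = same-kind v-d w-d
      (∸-monoʳ-< (s≤s q<p) (κ<width (parent v)))
    ≺⇒< {v} {w} (degrees v-l w-l d<) = same-kind v-l w-l
      (<-≤-trans (blockOffset-< v (inj₁ d<)) (m≤n+m _ (toℕ w)))
    ≺⇒< {v} {w} (blocks v-l w-l d≡ κ<) = same-kind v-l w-l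
      (<-≤-trans (blockOffset-< v (inj₂ (d≡ , κ<))) (m≤n+m _ (toℕ w)))
    ≺⇒< {v} {w} (siblings v-l w-l p≡q v<w) = same-kind v-l w-l
      (subst (λ p → toℕ v + blockOffset (parent v) < toℕ w + blockOffset p) p≡q
             (+-monoˡ-< (blockOffset (parent v)) v<w))

    module _ (κ-injective : ∀ {v w} → κ v ≡ κ w → v ≡ w) where

      -- A tie between the parents means a common parent, since `κ` is injective. Below and direct
      -- vertices are only children, so for them this forces `v ≡ w`; links are then separated by
      -- index.
      ≺-connected : ∀ {v w} → v ≢ w → v ≺ w ⊎ w ≺ v
      ≺-connected {v} {w} v≢w with <-cmp (tier (kind v)) (tier (kind w))
      ... | tri< t< _ _ = inj₁ (tiers t<)
      ... | tri> _ _ t> = inj₂ (tiers t>)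
      ... | tri≈ _ t≡ _ = equal-kind (kind v) refl (sym (tier-injective t≡))
        where
        equal-kind : ∀ c → kind v ≡ c → kind w ≡ kind v → v ≺ w ⊎ w ≺ v
        equal-kind root v-r w≡v with <-cmp (toℕ v) (toℕ w)
        ... | tri< v<w _ _ = inj₁ (roots v-r (trans w≡v v-r) v<w)
        ... | tri≈ _ v≡w _ = contradiction (toℕ-injective v≡w) v≢w
        ... | tri> _ _ w<v = inj₂ (roots (trans w≡v v-r) v-r w<v)
        equal-kind below v-b w≡v with <-cmp (κ (parent v)) (κ (parent w))
        ... | tri< p<q _ _ = inj₁ (belows v-b (trans w≡v v-b) p<q)
        ... | tri≈ _ p≡q _ = contradiction
                (below-only-child (trans w≡v v-b) (below⇒nonroot v-b , κ-injective p≡q)) v≢w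
        ... | tri> _ _ q<p = inj₂ (belows (trans w≡v v-b) v-b q<p)
        equal-kind direct v-d w≡v with <-cmp (κ (parent v)) (κ (parent w))
        ... | tri> _ _ q<p = inj₁ (directs v-d (trans w≡v v-d) q<p)
        ... | tri≈ _ p≡q _ = contradiction
                (direct-only-child (trans w≡v v-d) (direct⇒nonroot v-d , κ-injective p≡q)) v≢w
        ... | tri< p<q _ _ = inj₂ (directs (trans w≡v v-d) v-d p<q)
        equal-kind link v-l w≡v
          with <-cmp (linkDegree (parent v)) (linkDegree (parent w))
        ... | tri< d< _ _ = inj₁ (degrees v-l (trans w≡v v-l) d<)
        ... | tri> _ _ d> = inj₂ (degrees (trans w≡v v-l) v-l d>)
        ... | tri≈ _ d≡ _ with <-cmp (κ (parent v)) (κ (parent w))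
        ...   | tri< p<q _ _ = inj₁ (blocks v-l (trans w≡v v-l) d≡ p<q)
        ...   | tri> _ _ q<p = inj₂ (blocks (trans w≡v v-l) v-l (sym d≡) q<p)
        ...   | tri≈ _ p≡q _ with <-cmp (toℕ v) (toℕ w)
        ...     | tri< v<w _ _ = inj₁ (siblings v-l (trans w≡v v-l) (κ-injective p≡q) v<w)
        ...     | tri≈ _ v≡w _ = contradiction (toℕ-injective v≡w) v≢w
        ...     | tri> _ _ w<v = inj₂ (siblings (trans w≡v v-l) v-l (sym (κ-injective p≡q)) w<v)

      key-injective : ∀ {v w} → key v ≡ key w → v ≡ w
      key-injective {v} {w} kv≡kw with v Fin.≟ w
      ... | yes v≡w = v≡w
      ... | no v≢w with ≺-connected v≢w
      ...   | inj₁ v≺w = contradiction kv≡kw (<⇒≢ (≺⇒< v≺w))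
      ...   | inj₂ w≺v = contradiction (sym kv≡kw) (<⇒≢ (≺⇒< w≺v))

      -- Connectedness reverses `≺⇒<`, so that an inequality between keys can be taken apart into
      -- its structural reason.
      <⇒≺ : ∀ {v w} → key v < key w → v ≺ w
      <⇒≺ {v} {w} kv<kw with ≺-connected {v} {w} (<⇒≢ kv<kw ∘ cong key)
      ... | inj₁ v≺w = v≺w
      ... | inj₂ w≺v = contradiction (≺⇒< w≺v) (<-asym kv<kw)

  -- The intended order refers to itself at the parents, so it is reached by
  -- iteration: later steps no longer change the order of the vertices of depth
  -- at most s.
  keyAt : ℕ → Fin k → ℕ
  keyAt zero    = toℕ
  keyAt (suc s) = Step.key (keyAt s)

  keyAt-injective : ∀ s {v w} → keyAt s v ≡ keyAt s w → v ≡ w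
  keyAt-injective zero    = toℕ-injective
  keyAt-injective (suc s) = Step.key-injective (keyAt s) (keyAt-injective s)

  -- Induction on `s`. At depth 0 there are only roots, always compared by index. Otherwise the
  -- reason for `v` preceding `w` either does not involve the previous stage or compares parents
  -- there; these are less deep, so their comparison persists.
  keyAt-stable : ∀ s {v w} → depth v ≤ s → depth w ≤ s →
                 keyAt s v < keyAt s w → keyAt (suc s) v < keyAt (suc s) w
  keyAt-stable zero {v} {w} v≤ w≤ v<w =
    Step.≺⇒< toℕ (Step.roots (depth≤0⇒root v≤) (depth≤0⇒root w≤) v<w)
    where
    depth≤0⇒root : ∀ {u} → depth u ≤ 0 → kind u ≡ root
    depth≤0⇒root {u} u≤0 with kind u ≟ᴷ root
    ... | yes u-root = u-root
    ... | no ¬root = contradiction (<-≤-trans (depth-parent ¬root) u≤0) λ ()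
  keyAt-stable (suc s) {v} {w} v≤ w≤ v<w =
    Step.≺⇒< (keyAt (suc s)) (promote (Step.<⇒≺ (keyAt s) (keyAt-injective s) v<w))
    where
    parent≤ : ∀ {u} → kind u ≢ root → depth u ≤ suc s → depth (parent u) ≤ s
    parent≤ ¬root u≤ = ≤-pred (<-≤-trans (depth-parent ¬root) u≤)
    promote : Step._≺_ (keyAt s) v w → Step._≺_ (keyAt (suc s)) v w
    promote (Step.tiers t<) = Step.tiers t<
    promote (Step.roots v-r w-r v<w) = Step.roots v-r w-r v<w
    promote (Step.belows v-b w-b p<q) = Step.belows v-b w-b
      (keyAt-stable s (parent≤ (below⇒nonroot v-b) v≤) (parent≤ (below⇒nonroot w-b) w≤) p<q)
    promote (Step.directs v-d w-d q<p) = Step.directs v-d w-d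
      (keyAt-stable s (parent≤ (direct⇒nonroot w-d) w≤) (parent≤ (direct⇒nonroot v-d) v≤) q<p)
    promote (Step.degrees v-l w-l d<) = Step.degrees v-l w-l d<
    promote (Step.blocks v-l w-l d≡ p<q) = Step.blocks v-l w-l d≡
      (keyAt-stable s (parent≤ (link⇒nonroot v-l) v≤) (parent≤ (link⇒nonroot w-l) w≤) p<q)
    promote (Step.siblings v-l w-l p≡q v<w) = Step.siblings v-l w-l p≡q v<w

  -- The stage `sum depth` bounds every depth, so `final` extends the order `κ` from which it was
  -- computed: at this stage the order of the labels agrees with its own recursive description.
  κ final : Fin k → ℕ
  κ     = keyAt (sum depth)
  final = keyAt (suc (sum depth))

  κ-injective : ∀ {v w} → κ v ≡ κ w → v ≡ w
  κ-injective = keyAt-injective (sum depth)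

  final-injective : ∀ {v w} → final v ≡ final w → v ≡ w
  final-injective = keyAt-injective (suc (sum depth))

  κ-<⇒final-< : ∀ {v w} → κ v < κ w → final v < final w
  κ-<⇒final-< {v} {w} =
    keyAt-stable (sum depth) (term≤sum depth v) (term≤sum depth w)

  open Step κ public using (≺⇒<; tiers; belows; directs)

  open Rank nonroot? final final-injective public

  -- The factor 3 is `tier link`. Counting the keys before this value gives the threshold `t` that
  -- separates the links below `p` from what precedes them.
  blockStart : Fin k → ℕ
  blockStart p = 3 * Step.width κ + Step.blockOffset κ p

  ¬link⇒final<blockStart : ∀ {v p} → kind v ≢ link → final v < blockStart p
  ¬link⇒final<blockStart {v} {p} ¬link = ≤-trans (Step.key<nextTier κ ¬link)
    (≤-trans (*-monoˡ-≤ (Step.width κ) (tier<3 (kind v) ¬link)) (m≤m+n _ _))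
    where
    tier<3 : ∀ c → c ≢ link → tier c < 3
    tier<3 root   _  = s≤s z≤n
    tier<3 below  _  = s≤s (s≤s z≤n)
    tier<3 direct _  = s≤s (s≤s (s≤s z≤n))
    tier<3 link   ¬l = contradiction refl ¬l

  blockStart≤final : ∀ {u p} → UpArc u p → blockStart p ≤ final u
  blockStart≤final {u} {p} (u-link , refl) = subst (blockStart p ≤_) (sym (Step.key-of κ u-link))
    (+-monoʳ-≤ (3 * Step.width κ) (m≤n+m _ (toℕ u)))

  final<blockStart : ∀ {u p q} → UpArc u p →
    linkDegree p < linkDegree q ⊎ (linkDegree p ≡ linkDegree q × κ p < κ q) →
    final u < blockStart q
  final<blockStart {u} {p} {q} (u-link , refl) p<q = subst (_< blockStart q)
    (sym (Step.key-of κ u-link))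
    (+-monoʳ-< (3 * Step.width κ) (Step.blockOffset-< κ u p<q))

-- Integer differences and arc weights

m-n≡o-p⇒m+p≡o+n : ∀ m n o p → pos m ℤ.- pos n ≡ pos o ℤ.- pos p → m + p ≡ o + n
m-n≡o-p⇒m+p≡o+n m n o p m-n≡o-p = ℤ.+-injective (begin
  pos m ℤ.+ pos p
    ≡⟨ cong (λ x → x ℤ.+ pos p) (add-back (pos m) (pos n)) ⟩
  (pos m ℤ.- pos n ℤ.+ pos n) ℤ.+ pos p
    ≡⟨ cong (λ x → (x ℤ.+ pos n) ℤ.+ pos p) m-n≡o-p ⟩
  (pos o ℤ.- pos p ℤ.+ pos n) ℤ.+ pos p
    ≡⟨ ℤ.+-assoc (pos o ℤ.- pos p) (pos n) (pos p) ⟩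
  (pos o ℤ.- pos p) ℤ.+ (pos n ℤ.+ pos p)
    ≡⟨ cong (λ x → (pos o ℤ.- pos p) ℤ.+ x) (ℤ.+-comm (pos n) (pos p)) ⟩
  (pos o ℤ.- pos p) ℤ.+ (pos p ℤ.+ pos n)
    ≡⟨ ℤ.+-assoc (pos o ℤ.- pos p) (pos p) (pos n) ⟨
  (pos o ℤ.- pos p ℤ.+ pos p) ℤ.+ pos n
    ≡⟨ cong (λ x → x ℤ.+ pos n) (add-back (pos o) (pos p)) ⟨
  pos o ℤ.+ pos n ∎)
  where
  open ≡-Reasoning
  add-back : ∀ i j → i ≡ i ℤ.- j ℤ.+ j
  add-back i j = sym (trans (ℤ.+-assoc i (ℤ.- j) j)
    (trans (cong (λ x → i ℤ.+ x) (ℤ.+-inverseˡ j)) (ℤ.+-identityʳ i)))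

module _ {n m : ℕ} (D : Digraph n) (τ : Digraph.Labeling D m) where

  open Digraph D

  weight-arc : ∀ {u v} (u⟶v : u ⟶ v) → weight τ u v ≡ label τ (arc u⟶v)
  weight-arc {u} {v} u⟶v with T? (arc? u v)
  ... | yes u⟶v′ = cong (λ p → label τ (arc p)) (T-irrelevant u⟶v′ u⟶v)
  ... | no ¬u⟶v  = contradiction u⟶v ¬u⟶v

  weight-nonarc : ∀ {u v} → ¬ (u ⟶ v) → weight τ u v ≡ 0
  weight-nonarc {u} {v} ¬u⟶v with T? (arc? u v)
  ... | yes u⟶v = contradiction u⟶v ¬u⟶v
  ... | no _    = refl

-- Antimagic orientations of typed forests

module Orientation {k : ℕ} (S : TypedForest k) where

  open TypedForest S
  open Order S

  -- The label of the arc between `v` and its parent; the successor matches the shift in `label`. At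
  -- a root the value labels no arc.
  lab : Fin k → ℕ
  lab v = suc (rank v)

  lab-mono-< : ∀ {v w} → kind v ≢ root → final v < final w → lab v < lab w
  lab-mono-< ¬root v<w = s≤s (rank-mono-< ¬root v<w)

  tier-<⇒lab-< : ∀ {v w} → kind v ≢ root → tier (kind v) < tier (kind w) → lab v < lab w
  tier-<⇒lab-< ¬root t< = lab-mono-< ¬root (≺⇒< (tiers t<))

  arcDec : ∀ u v → Dec (UpArc u v ⊎ DownArc u v)
  arcDec u v = upArc? u v ⊎-dec downArc? u v

  arc⇒child : ∀ {u v} → UpArc u v ⊎ DownArc u v → Child u v ⊎ Child v u
  arc⇒child (inj₁ (u-link , pu≡v))         = inj₁ (link⇒nonroot u-link , pu≡v)
  arc⇒child (inj₂ ((¬root , _) , pv≡u)) = inj₂ (¬root , pv≡u)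

  child⇒arc : ∀ {u v} → Child u v → (UpArc u v ⊎ DownArc u v) ⊎ (UpArc v u ⊎ DownArc v u)
  child⇒arc {u} (¬root , pu≡v) with kind u ≟ᴷ link
  ... | yes u-link = inj₁ (inj₁ (u-link , pu≡v))
  ... | no ¬link   = inj₂ (inj₂ ((¬root , ¬link) , pu≡v))

  child-asym : ∀ {u v} → Child u v → ¬ Child v u
  child-asym u→v v→u = <-asym (child-depth u→v) (child-depth v→u)
    where
    child-depth : ∀ {x y} → Child x y → depth y < depth x
    child-depth (¬root , refl) = depth-parent ¬root

  arc-asym : ∀ {u v} → UpArc u v ⊎ DownArc u v → ¬ (UpArc v u ⊎ DownArc v u)
  arc-asym (inj₁ (u-link , _)) (inj₂ ((_ , ¬link) , _)) = ¬link u-link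
  arc-asym (inj₂ ((_ , ¬link) , _)) (inj₁ (v-link , _)) = ¬link v-link
  arc-asym (inj₁ (u-link , pu≡v)) (inj₁ (v-link , pv≡u)) =
    child-asym (link⇒nonroot u-link , pu≡v) (link⇒nonroot v-link , pv≡u)
  arc-asym (inj₂ ((¬rv , _) , pv≡u)) (inj₂ ((¬ru , _) , pu≡v)) =
    child-asym (¬ru , pu≡v) (¬rv , pv≡u)

  digraph : Digraph k
  digraph = record
    { arc?       = λ u v → ⌊ arcDec u v ⌋
    ; asymmetric = λ {u} {v} u⟶v v⟶u →
        arc-asym (toWitness {a? = arcDec u v} u⟶v) (toWitness {a? = arcDec v u} v⟶u)
    }

  open Digraph digraph

  -- Sending an arc to its end farther from the root identifies arcs with nonroot vertices, which
  -- `rank` numbers bijectively.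
  lowerEnd : ∀ {u v} → UpArc u v ⊎ DownArc u v → Fin k
  lowerEnd {u} {v} = [ (λ _ → u) , (λ _ → v) ]′

  lowerEnd-nonroot : ∀ {u v} (a : UpArc u v ⊎ DownArc u v) → kind (lowerEnd a) ≢ root
  lowerEnd-nonroot (inj₁ (u-link , _))      = link⇒nonroot u-link
  lowerEnd-nonroot (inj₂ ((¬root , _) , _)) = ¬root

  view : (a : Arc) → UpArc (Arc.source a) (Arc.target a) ⊎ DownArc (Arc.source a) (Arc.target a)
  view (arc {u} {v} u⟶v) = toWitness {a? = arcDec u v} u⟶v

  lowerEnd-injective : ∀ {u v u′ v′} (a : UpArc u v ⊎ DownArc u v)
                       (b : UpArc u′ v′ ⊎ DownArc u′ v′) → lowerEnd a ≡ lowerEnd b → u ≡ u′ × v ≡ v′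
  lowerEnd-injective (inj₁ (_ , refl)) (inj₁ (_ , refl)) refl = refl , refl
  lowerEnd-injective (inj₂ (_ , refl)) (inj₂ (_ , refl)) refl = refl , refl
  lowerEnd-injective (inj₁ (l , _)) (inj₂ ((_ , ¬l) , _)) refl = contradiction l ¬l
  lowerEnd-injective (inj₂ ((_ , ¬l) , _)) (inj₁ (l , _)) refl = contradiction l ¬l

  arc-≡ : ∀ (a b : Arc) → Arc.source a ≡ Arc.source b → Arc.target a ≡ Arc.target b → a ≡ b
  arc-≡ (arc p) (arc q) refl refl = cong arc (T-irrelevant p q)

  index : Arc → Fin total
  index a = fromℕ< (rank<total (lowerEnd-nonroot (view a)))

  toℕ-index : ∀ a → toℕ (index a) ≡ rank (lowerEnd (view a))
  toℕ-index a = toℕ-fromℕ< _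

  index-injective : ∀ {a b} → index a ≡ index b → a ≡ b
  index-injective {a} {b} ia≡ib = uncurry (arc-≡ a b)
    (lowerEnd-injective (view a) (view b)
      (rank-injective (lowerEnd-nonroot (view a)) (lowerEnd-nonroot (view b))
        (trans (sym (toℕ-index a)) (trans (cong toℕ ia≡ib) (toℕ-index b)))))

  -- The view recovered from a Boolean need not be the given one. Both still single out the same
  -- end, since two vertices cannot be parents of each other.
  lowerEnd-unique : ∀ {u v} (a b : UpArc u v ⊎ DownArc u v) → lowerEnd a ≡ lowerEnd b
  lowerEnd-unique (inj₁ _) (inj₁ _) = refl
  lowerEnd-unique (inj₂ _) (inj₂ _) = refl
  lowerEnd-unique (inj₁ (l , pu≡v)) (inj₂ ((¬r , _) , pv≡u)) =
    contradiction (¬r , pv≡u) (child-asym (link⇒nonroot l , pu≡v))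
  lowerEnd-unique (inj₂ ((¬r , _) , pv≡u)) (inj₁ (l , pu≡v)) =
    contradiction (¬r , pv≡u) (child-asym (link⇒nonroot l , pu≡v))

  arc-view : ∀ {u v} → UpArc u v ⊎ DownArc u v → u ⟶ v
  arc-view {u} {v} a = fromWitness {a? = arcDec u v} a

  nonroot⇒arc : ∀ {v} → kind v ≢ root → ∃[ a ] lowerEnd (view a) ≡ v
  nonroot⇒arc {v} ¬root with kind v ≟ᴷ link
  ... | yes v-link = arc (arc-view up) , lowerEnd-unique (view (arc (arc-view up))) up
    where
    up : UpArc v (parent v) ⊎ DownArc v (parent v)
    up = inj₁ (v-link , refl)
  ... | no ¬link = arc (arc-view down) , lowerEnd-unique (view (arc (arc-view down))) down
    where
    down : UpArc (parent v) v ⊎ DownArc (parent v) v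
    down = inj₂ ((¬root , ¬link) , refl)

  index-surjective : ∀ i → ∃[ a ] (∀ {b} → b ≡ a → index b ≡ i)
  index-surjective i with rank-surjective (toℕ<n i)
  ... | v , ¬root , rv≡i with nonroot⇒arc ¬root
  ...   | a , end≡v = a , λ { refl → toℕ-injective
            (trans (toℕ-index a) (trans (cong rank end≡v) rv≡i)) }

  labeling : Labeling total
  labeling = mk⤖ (index-injective , index-surjective)

  upLabel downLabel : Fin k → Fin k → ℕ
  upLabel   u v = when (upArc? u v) (lab u)
  downLabel u v = when (downArc? u v) (lab v)

  -- At most one summand is nonzero, as an up-arc and a down-arc from `u` to `v` would make each the
  -- parent of the other. The split separates the contributions of links from those of the other
  -- vertices.
  weight≡ : ∀ u v → weight labeling u v ≡ upLabel u v + downLabel u v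
  weight≡ u v = by-cases (arcDec u v)
    where
    arc-weight : (a : UpArc u v ⊎ DownArc u v) → weight labeling u v ≡ lab (lowerEnd a)
    arc-weight a = trans (weight-arc digraph labeling (arc-view a))
      (cong suc (trans (toℕ-index (arc (arc-view a)))
                       (cong rank (lowerEnd-unique (view (arc (arc-view a))) a))))
    exclusive : UpArc u v → ¬ DownArc u v
    exclusive (l , pu≡v) ((¬r , _) , pv≡u) = child-asym (link⇒nonroot l , pu≡v) (¬r , pv≡u)
    by-cases : Dec (UpArc u v ⊎ DownArc u v) → weight labeling u v ≡ upLabel u v + downLabel u v
    by-cases (no ¬a) = trans (weight-nonarc digraph labeling (¬a ∘ toWitness {a? = arcDec u v}))
      (sym (cong₂ _+_ (when-no (upArc? u v) (¬a ∘ inj₁)) (when-no (downArc? u v) (¬a ∘ inj₂))))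
    by-cases (yes (inj₁ up)) = trans (arc-weight (inj₁ up)) (sym (trans
      (cong₂ _+_ (when-yes (upArc? u v) up) (when-no (downArc? u v) (exclusive up)))
      (+-identityʳ (lab u))))
    by-cases (yes (inj₂ down)) = trans (arc-weight (inj₂ down)) (sym
      (cong₂ _+_ (when-no (upArc? u v) (λ up → exclusive up down))
                 (when-yes (downArc? u v) down)))

  -- Incoming and outgoing sums at a vertex

  own lowerOwn fromLinks fromLowers : Fin k → ℕ
  own v        = when (kind v ≟ᴷ link) (lab v)
  lowerOwn v   = when (lower? v) (lab v)
  fromLinks v  = sum (λ u → upLabel u v)
  fromLowers v = sum (λ w → downLabel v w)

  inSum outSum : Fin k → ℕ
  inSum v  = fromLinks v + lowerOwn v
  outSum v = own v + fromLowers v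

  inSum≡ : ∀ v → sum (λ u → weight labeling u v) ≡ inSum v
  inSum≡ v = begin
    sum (λ u → weight labeling u v)
      ≡⟨ sum-cong-≗ (λ u → weight≡ u v) ⟩
    sum (λ u → upLabel u v + downLabel u v)
      ≡⟨ ∑-distrib-+ (λ u → upLabel u v) (λ u → downLabel u v) ⟩
    fromLinks v + sum (λ u → downLabel u v)
      ≡⟨ cong (fromLinks v +_) (sum-single (parent v) elsewhere) ⟩
    fromLinks v + downLabel (parent v) v
      ≡⟨ cong (fromLinks v +_) (at-parent (lower? v)) ⟩
    inSum v ∎
    where
    open ≡-Reasoning
    elsewhere : ∀ u → u ≢ parent v → downLabel u v ≡ 0
    elsewhere u u≢p = when-no (downArc? u v) (λ (_ , p≡u) → u≢p (sym p≡u))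
    at-parent : (l? : Dec (kind v ≢ root × kind v ≢ link)) →
                downLabel (parent v) v ≡ when l? (lab v)
    at-parent (yes l) = when-yes (downArc? (parent v) v) (l , refl)
    at-parent (no ¬l) = when-no (downArc? (parent v) v) (λ (l , _) → ¬l l)

  outSum≡ : ∀ v → sum (λ w → weight labeling v w) ≡ outSum v
  outSum≡ v = begin
    sum (λ w → weight labeling v w)
      ≡⟨ sum-cong-≗ (λ w → weight≡ v w) ⟩
    sum (λ w → upLabel v w + downLabel v w)
      ≡⟨ ∑-distrib-+ (λ w → upLabel v w) (λ w → downLabel v w) ⟩
    sum (λ w → upLabel v w) + fromLowers v
      ≡⟨ cong (_+ fromLowers v) (sum-single (parent v) elsewhere) ⟩
    upLabel v (parent v) + fromLowers v
      ≡⟨ cong (_+ fromLowers v) (at-parent (kind v ≟ᴷ link)) ⟩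
    outSum v ∎
    where
    open ≡-Reasoning
    elsewhere : ∀ w → w ≢ parent v → upLabel v w ≡ 0
    elsewhere w w≢p = when-no (upArc? v w) (λ (_ , p≡w) → w≢p (sym p≡w))
    at-parent : (l? : Dec (kind v ≡ link)) → upLabel v (parent v) ≡ when l? (lab v)
    at-parent (yes l) = when-yes (upArc? v (parent v)) (l , refl)
    at-parent (no ¬l) = when-no (upArc? v (parent v)) (λ (l , _) → ¬l l)

  vertexSum≡⇒ : ∀ {v w} → vertexSum labeling v ≡ vertexSum labeling w →
                inSum v + outSum w ≡ inSum w + outSum v
  vertexSum≡⇒ {v} {w} sv≡sw = m-n≡o-p⇒m+p≡o+n (inSum v) (outSum v) (inSum w) (outSum w)
    (trans (sym (split v)) (trans sv≡sw (split w)))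
    where
    split : ∀ u → vertexSum labeling u ≡ pos (inSum u) ℤ.- pos (outSum u)
    split u = cong₂ (λ i o → pos i ℤ.- pos o) (inSum≡ u) (outSum≡ u)

  -- The shapes are named after the sign of the vertex sum, except that `positive` includes 0 and
  -- that `linking` sums are negative too.
  data Shape (v : Fin k) : Set where
    positive : kind v ≢ link → outSum v ≡ 0 → Shape v
    negative : ∀ {d} → kind v ≡ below → kind d ≡ direct → parent d ≡ v →
               inSum v ≡ lab v → outSum v ≡ lab d → Shape v
    linking  : ∀ {c} → kind v ≡ link → kind c ≡ below → parent c ≡ v →
               inSum v ≡ 0 → outSum v ≡ lab v + lab c → Shape v

  fromLinks-zero : ∀ {v} → (∀ u → ¬ UpArc u v) → fromLinks v ≡ 0
  fromLinks-zero {v} none = sum-zero λ u → when-no (upArc? u v) (none u)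

  fromLowers-single : ∀ {v} c → DownArc v c → (∀ {u} → Child u v → u ≡ c) →
                      fromLowers v ≡ lab c
  fromLowers-single {v} c down only = trans
    (sum-single c λ w w≢c → when-no (downArc? v w) λ ((¬r , _) , p) → w≢c (only (¬r , p)))
    (when-yes (downArc? v c) down)

  lower-kind : ∀ {v} → kind v ≢ root → kind v ≢ link → kind v ≡ below ⊎ kind v ≡ direct
  lower-kind {v} = cases (kind v)
    where
    cases : ∀ c → c ≢ root → c ≢ link → c ≡ below ⊎ c ≡ direct
    cases root   ¬r ¬l = contradiction refl ¬r
    cases below  ¬r ¬l = inj₁ refl
    cases direct ¬r ¬l = inj₂ refl
    cases link   ¬r ¬l = contradiction refl ¬l

  below⇒¬link : ∀ {v} → kind v ≡ below → kind v ≢ link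
  below⇒¬link b l with () ← trans (sym b) l

  direct⇒¬link : ∀ {v} → kind v ≡ direct → kind v ≢ link
  direct⇒¬link d l with () ← trans (sym d) l

  -- A child of a nonlink is a link or direct, because parents of below vertices are links. Links
  -- send their arcs upwards, so without a direct child nothing leaves a nonlink.
  shape : ∀ v → Shape v
  shape v = link-or-not (kind v ≟ᴷ link)
    where
    directChild? : Dec (∃[ d ] kind d ≡ direct × parent d ≡ v)
    directChild? = any? λ d → (kind d ≟ᴷ direct) ×-dec (parent d Fin.≟ v)

    not-link : kind v ≢ link → Dec (∃[ d ] kind d ≡ direct × parent d ≡ v) → Shape v
    not-link ¬l (yes (d , d-direct , refl)) =
      negative (direct-parent d-direct) d-direct refl
        (cong₂ _+_
          (fromLinks-zero λ u (u-link , pu≡v) →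
            direct⇒¬link d-direct (subst (λ x → kind x ≡ link)
              (direct-only-child d-direct (link⇒nonroot u-link , pu≡v)) u-link))
          (when-yes (lower? v) (below⇒nonroot (direct-parent d-direct) , ¬l)))
        (cong₂ _+_ (when-no (kind v ≟ᴷ link) ¬l)
          (fromLowers-single d ((direct⇒nonroot d-direct , direct⇒¬link d-direct) , refl)
            (direct-only-child d-direct)))
    not-link ¬l (no none) = positive ¬l (cong₂ _+_
      (when-no (kind v ≟ᴷ link) ¬l)
      (sum-zero λ w → when-no (downArc? v w) (no-lower w)))
      where
      no-lower : ∀ w → ¬ DownArc v w
      no-lower w ((¬r , ¬lw) , pw≡v) with lower-kind ¬r ¬lw
      ... | inj₁ w-below  = ¬l (trans (cong kind (sym pw≡v)) (below-parent w-below))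
      ... | inj₂ w-direct = none (w , w-direct , pw≡v)

    link-or-not : Dec (kind v ≡ link) → Shape v
    link-or-not (no ¬l) = not-link ¬l directChild?
    link-or-not (yes l) with link-child l
    ... | c , c-below , refl =
      linking l c-below refl
        (cong₂ _+_
          (fromLinks-zero λ u (u-link , pu≡v) → link-parent u-link (trans (cong kind pu≡v) l))
          (when-no (lower? v) (λ (_ , ¬l) → ¬l l)))
        (cong₂ _+_ (when-yes (kind v ≟ᴷ link) l)
          (fromLowers-single c ((below⇒nonroot c-below , below⇒¬link c-below) , refl)
            (below-only-child c-below)))

  -- Comparing nonnegative sums

  module Separation {v w : Fin k}
    (v<w : linkDegree v < linkDegree w ⊎ (linkDegree v ≡ linkDegree w × κ v < κ w)) where

    t : ℕ
    -- A nonroot vertex has label at most `t` exactly if its key is less than `blockStart w`.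
    t = countBefore (blockStart w)

    open ≤-Reasoning

    fromLinks-≤ : fromLinks v ≤ linkDegree v * t
    fromLinks-≤ = begin
      fromLinks v                              ≤⟨ sum-mono-≤ (λ u → term (upArc? u v)) ⟩
      sum (λ u → when (upArc? u v) 1 * t)      ≡⟨ sum-*ʳ (λ u → when (upArc? u v) 1) t ⟩
      linkDegree v * t                         ∎
      where
      term : ∀ {u} (a : Dec (UpArc u v)) → when a (lab u) ≤ when a 1 * t
      term (no _)    = z≤n
      term (yes up) = ≤-trans
        (countBefore-mono-< (link⇒nonroot (proj₁ up)) ≤-refl (final<blockStart up v<w))
        (≤-reflexive (sym (+-identityʳ t)))

    fromLinks-≥ : linkDegree w * suc t ≤ fromLinks w
    fromLinks-≥ = begin
      linkDegree w * suc t                     ≡⟨ sum-*ʳ (λ u → when (upArc? u w) 1) (suc t) ⟨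
      sum (λ u → when (upArc? u w) 1 * suc t)  ≤⟨ sum-mono-≤ (λ u → term (upArc? u w)) ⟩
      fromLinks w                              ∎
      where
      term : ∀ {u} (a : Dec (UpArc u w)) → when a 1 * suc t ≤ when a (lab u)
      term (no _)    = z≤n
      term (yes up) = ≤-trans (≤-reflexive (+-identityʳ (suc t)))
        (s≤s (countBefore-mono-≤ (blockStart≤final up)))

    lowerOwn-≤ : lowerOwn v ≤ t
    lowerOwn-≤ = bound (lower? v)
      where
      bound : (l? : Dec (kind v ≢ root × kind v ≢ link)) → when l? (lab v) ≤ t
      bound (no _)          = z≤n
      bound (yes (¬r , ¬l)) = countBefore-mono-< ¬r ≤-refl (¬link⇒final<blockStart ¬l)

    degree-<⇒inSum-< : linkDegree v < linkDegree w → inSum v < inSum w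
    degree-<⇒inSum-< d< = begin-strict
      fromLinks v + lowerOwn v        ≤⟨ +-mono-≤ fromLinks-≤ lowerOwn-≤ ⟩
      linkDegree v * t + t            ≡⟨ +-comm (linkDegree v * t) t ⟩
      suc (linkDegree v) * t          ≤⟨ *-monoˡ-≤ t d< ⟩
      -- Strict because `linkDegree w` exceeds another degree and is thus positive; `t` itself may
      -- be 0.
      linkDegree w * t                <⟨ +-monoˡ-< (linkDegree w * t) (≤-<-trans z≤n d<) ⟩
      linkDegree w + linkDegree w * t ≡⟨ *-suc (linkDegree w) t ⟨
      linkDegree w * suc t            ≤⟨ fromLinks-≥ ⟩
      fromLinks w                     ≤⟨ m≤m+n (fromLinks w) (lowerOwn w) ⟩
      inSum w                         ∎

    degree-≡⇒fromLinks-≤ : linkDegree v ≡ linkDegree w → fromLinks v ≤ fromLinks w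
    degree-≡⇒fromLinks-≤ d≡ = begin
      fromLinks v          ≤⟨ fromLinks-≤ ⟩
      linkDegree v * t     ≡⟨ cong (_* t) d≡ ⟩
      linkDegree w * t     ≤⟨ *-monoʳ-≤ (linkDegree w) (n≤1+n t) ⟩
      linkDegree w * suc t ≤⟨ fromLinks-≥ ⟩
      fromLinks w          ∎

    degree-≡⇒fromLinks-< : linkDegree v ≡ linkDegree w → 0 < linkDegree w →
                           fromLinks v < fromLinks w
    degree-≡⇒fromLinks-< d≡ 0<d = begin-strict
      fromLinks v                     ≤⟨ fromLinks-≤ ⟩
      linkDegree v * t                ≡⟨ cong (_* t) d≡ ⟩
      linkDegree w * t                <⟨ +-monoˡ-< (linkDegree w * t) 0<d ⟩
      linkDegree w + linkDegree w * t ≡⟨ *-suc (linkDegree w) t ⟨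
      linkDegree w * suc t            ≤⟨ fromLinks-≥ ⟩
      fromLinks w                     ∎

  -- All children of a root are links: a below vertex hangs from a link, a direct one from a below
  -- vertex.
  linkDegree-zero⇒childless : ∀ {r} → kind r ≡ root → linkDegree r ≡ 0 → ∀ u → ¬ Child u r
  linkDegree-zero⇒childless {r} r-root d≡0 u (¬root , pu≡r) with kind u ≟ᴷ link
  ... | yes u-link = contradiction
        (subst₂ _≤_ (when-yes (upArc? u r) (u-link , pu≡r)) d≡0
          (term≤sum (λ x → when (upArc? x r) 1) u)) λ ()
  ... | no ¬l with lower-kind ¬root ¬l
  ...   | inj₁ u-below  = link⇒nonroot (below-parent u-below) (trans (cong kind pu≡r) r-root)
  ...   | inj₂ u-direct = below⇒nonroot (direct-parent u-direct) (trans (cong kind pu≡r) r-root)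

  root-below-root : ∀ {v w} → final v < final w → kind w ≡ root → kind v ≡ root
  root-below-root {v} {w} v<w w-root with kind v ≟ᴷ root
  ... | yes v-root = v-root
  ... | no ¬root = contradiction v<w (<-asym (≺⇒< (tiers
          (subst (λ c → tier c < tier (kind v)) (sym w-root) (0<tier (kind v) ¬root)))))
    where
    0<tier : ∀ c → c ≢ root → 0 < tier c
    0<tier root   ¬r = contradiction refl ¬r
    0<tier below  _  = z<s
    0<tier direct _  = z<s
    0<tier link   _  = z<s

  -- If `w` is not a root, its own label makes the difference. If it is, then so is the earlier `v`,
  -- and strictness must come from the links; there are some, for otherwise both roots would be
  -- childless and equal.
  positive-< : ∀ {v w} → kind v ≢ link → kind w ≢ link →
               linkDegree v ≡ linkDegree w → κ v < κ w → inSum v < inSum w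
  positive-< {v} {w} ¬lv ¬lw d≡ v<w = by-root (kind w ≟ᴷ root)
    where
    open Separation {v} {w} (inj₂ (d≡ , v<w))

    own-<-lab : (l? : Dec (kind v ≢ root × kind v ≢ link)) → when l? (lab v) < lab w
    own-<-lab (no _)         = z<s
    own-<-lab (yes (¬r , _)) = lab-mono-< ¬r (κ-<⇒final-< v<w)

    by-root : Dec (kind w ≡ root) → inSum v < inSum w
    by-root (no ¬root) = +-mono-≤-< (degree-≡⇒fromLinks-≤ d≡)
      (subst (lowerOwn v <_) (sym (when-yes (lower? w) (¬root , ¬lw))) (own-<-lab (lower? v)))
    by-root (yes w-root) = +-mono-<-≤ (degree-≡⇒fromLinks-< d≡ (n≢0⇒n>0 d≢0))
      (≤-trans (≤-reflexive (when-no (lower? v) (λ (¬r , _) → ¬r v-root))) z≤n)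
      where
      v-root : kind v ≡ root
      v-root = root-below-root (κ-<⇒final-< v<w) w-root
      d≢0 : linkDegree w ≢ 0
      d≢0 d≡0 = <⇒≢ v<w (cong κ (one-childless-root v-root w-root
        (linkDegree-zero⇒childless v-root (trans d≡ d≡0))
        (linkDegree-zero⇒childless w-root d≡0)))

  positive-distinct : ∀ {v w} → kind v ≢ link → kind w ≢ link → v ≢ w → inSum v ≢ inSum w
  positive-distinct {v} {w} ¬lv ¬lw v≢w
    with <-cmp (linkDegree v) (linkDegree w) | <-cmp (κ v) (κ w)
  ... | tri< d< _ _ | _            = <⇒≢ (Separation.degree-<⇒inSum-< (inj₁ d<) d<)
  ... | tri> _ _ d> | _            = ≢-sym (<⇒≢ (Separation.degree-<⇒inSum-< (inj₁ d>) d>))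
  ... | tri≈ _ d≡ _ | tri< v<w _ _ = <⇒≢ (positive-< ¬lv ¬lw d≡ v<w)
  ... | tri≈ _ d≡ _ | tri≈ _ v≡w _ = contradiction (κ-injective v≡w) v≢w
  ... | tri≈ _ d≡ _ | tri> _ _ w<v = ≢-sym (<⇒≢ (positive-< ¬lw ¬lv (sym d≡) w<v))

  -- Comparing negative sums and different shapes

  link-sums-< : ∀ {v w c d} → kind v ≡ link → kind c ≡ below → parent c ≡ v →
                kind d ≡ below → parent d ≡ w → κ v < κ w →
                lab v + lab c < lab w + lab d
  link-sums-< {v} {w} {c} {d} l c-below refl d-below refl v<w = +-mono-<
    (lab-mono-< {v} {w} (link⇒nonroot l) (κ-<⇒final-< v<w))
    (lab-mono-< {c} {d} (below⇒nonroot c-below) (≺⇒< (belows c-below d-below v<w)))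

  -- This is `lab v - lab c < lab w - lab d` without subtraction. Direct vertices are ordered
  -- against their parents, so `lab v < lab w` comes with `lab d < lab c`.
  negative-sums-< : ∀ {v w c d} → kind v ≡ below → kind c ≡ direct → parent c ≡ v →
                    kind d ≡ direct → parent d ≡ w → κ v < κ w →
                    lab v + lab d < lab w + lab c
  negative-sums-< {v} {w} {c} {d} b c-direct refl d-direct refl v<w = +-mono-<
    (lab-mono-< {v} {w} (below⇒nonroot b) (κ-<⇒final-< v<w))
    (lab-mono-< {d} {c} (direct⇒nonroot d-direct) (≺⇒< (directs d-direct c-direct v<w)))

  below-<-direct : ∀ {v w} → kind v ≡ below → kind w ≡ direct → lab v < lab w
  below-<-direct b d = tier-<⇒lab-< (below⇒nonroot b)
    (subst₂ (λ x y → tier x < tier y) (sym b) (sym d) (s≤s (s≤s z≤n)))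

  direct-<-link : ∀ {v w} → kind v ≡ direct → kind w ≡ link → lab v < lab w
  direct-<-link d l = tier-<⇒lab-< (direct⇒nonroot d)
    (subst₂ (λ x y → tier x < tier y) (sym d) (sym l) (s≤s (s≤s (s≤s z≤n))))

  -- Sums of shape `linking` are less than those of shape `negative`, and these are less than 0, so
  -- only equal shapes require comparing `κ`.
  sums-distinct : ∀ {u v} → Shape u → Shape v → u ≢ v →
                  inSum u + outSum v ≢ inSum v + outSum u
  sums-distinct (positive ¬lu ou≡0) (positive ¬lv ov≡0) u≢v
    rewrite ou≡0 | ov≡0 = positive-distinct ¬lu ¬lv u≢v ∘ +-cancelʳ-≡ 0 _ _
  sums-distinct {u} {v} (positive _ ou≡0) (negative {d} b d-direct _ iv≡ ov≡) _
    rewrite ou≡0 | iv≡ | ov≡ | +-identityʳ (lab v) = >⇒≢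
      (<-≤-trans (below-<-direct {v} {d} b d-direct) (m≤n+m (lab d) (inSum u)))
  sums-distinct {u} {v} (positive _ ou≡0) (linking {c} _ _ _ iv≡ ov≡) _
    rewrite ou≡0 | iv≡ | ov≡ = >⇒≢ (<-≤-trans z<s (m≤n+m (lab v + lab c) (inSum u)))
  sums-distinct {u} {v} (negative {c} b c-direct pc≡u iu≡ ou≡)
                        (negative {d} b′ d-direct pd≡v iv≡ ov≡) u≢v
    rewrite iu≡ | ou≡ | iv≡ | ov≡ with <-cmp (κ u) (κ v)
  ... | tri< u<v _ _ = <⇒≢ (negative-sums-< {u} {v} b c-direct pc≡u d-direct pd≡v u<v)
  ... | tri≈ _ u≡v _ = contradiction (κ-injective u≡v) u≢v
  ... | tri> _ _ v<u = >⇒≢ (negative-sums-< {v} {u} b′ d-direct pd≡v c-direct pc≡u v<u)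
  sums-distinct {u} {v} (negative {d} b d-direct _ iu≡ ou≡) (linking {c} l _ _ iv≡ ov≡) _
    rewrite iu≡ | ou≡ | iv≡ | ov≡ = >⇒≢
      (<-≤-trans (direct-<-link {d} {v} d-direct l)
        (≤-trans (m≤m+n (lab v) (lab c)) (m≤n+m (lab v + lab c) (lab u))))
  sums-distinct {u} {v} (linking {c} l c-below pc≡u iu≡ ou≡)
                        (linking {d} l′ d-below pd≡v iv≡ ov≡) u≢v
    rewrite iu≡ | ou≡ | iv≡ | ov≡ with <-cmp (κ u) (κ v)
  ... | tri< u<v _ _ = >⇒≢ (link-sums-< {u} {v} l c-below pc≡u d-below pd≡v u<v)
  ... | tri≈ _ u≡v _ = contradiction (κ-injective u≡v) u≢v
  ... | tri> _ _ v<u = <⇒≢ (link-sums-< {v} {u} l′ d-below pd≡v c-below pc≡u v<u)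
  sums-distinct s@(negative _ _ _ _ _) t@(positive _ _) u≢v = ≢-sym (sums-distinct t s (≢-sym u≢v))
  sums-distinct s@(linking _ _ _ _ _) t@(positive _ _) u≢v = ≢-sym (sums-distinct t s (≢-sym u≢v))
  sums-distinct s@(linking _ _ _ _ _) t@(negative _ _ _ _ _) u≢v =
    ≢-sym (sums-distinct t s (≢-sym u≢v))

  antimagic : Antimagic labeling
  antimagic u v u≢v = sums-distinct (shape u) (shape v) u≢v ∘ vertexSum≡⇒

typedForest⇒antimagic : ∀ {k} (S : TypedForest k) (F : Graph k) → let open TypedForest S in
  (∀ u v → Graph.Adj F u v ⇔ (Child u v ⊎ Child v u)) → AdmitsAntimagicOrientation F
typedForest⇒antimagic S F adj⇔child = digraph , orientation , total , labeling , antimagic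
  where
  open TypedForest S
  open Order S using (total)
  open Orientation S
  open Digraph digraph using (_⟶_)

  orientation : digraph IsOrientationOf F
  orientation u v = mk⇔ forward backward
    where
    open Equivalence (adj⇔child u v)
    fromArc : ∀ {x y} → x ⟶ y → Child x y ⊎ Child y x
    fromArc {x} {y} x⟶y = arc⇒child (toWitness {a? = arcDec x y} x⟶y)
    toArc : ∀ {x y} → Child x y → x ⟶ y ⊎ y ⟶ x
    toArc x→y = [ (λ a → inj₁ (arc-view a)) , (λ a → inj₂ (arc-view a)) ]′ (child⇒arc x→y)
    forward : Graph.Adj F u v → u ⟶ v ⊎ v ⟶ u
    forward = [ toArc , swap ∘ toArc ]′ ∘ to
    backward : u ⟶ v ⊎ v ⟶ u → Graph.Adj F u v
    backward = from ∘ [ fromArc , swap ∘ fromArc ]′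

-- Ordering the vertices of an acyclic graph

module _ {n : ℕ} (H : Graph n) where

  open Graph H

  -- A rooting of the forest: the parent of a vertex is its neighbour of lower level, and vertices
  -- without one are roots.
  record TreeOrder : Set where
    field
      level           : Fin n → ℕ
      level-injective : ∀ {u v} → level u ≡ level v → u ≡ v
      unique-lower    : ∀ {v u w} → Adj v u → Adj v w →
                        level u < level v → level w < level v → u ≡ w

  module _ (acyclic : Forest) where

    open import Data.List.Membership.DecPropositional (Fin._≟_ {n}) using (_∈?_)

    TwoNeighbours : List (Fin n) → Fin n → Set
    TwoNeighbours xs v =
      ∃[ u ] ∃[ w ] (u ∈ xs × w ∈ xs) × (Adj v u × Adj v w) × u ≢ w

    twoNeighbours? : ∀ xs v → Dec (TwoNeighbours xs v)
    twoNeighbours? xs v = any? λ u → any? λ w →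
      ((u ∈? xs) ×-dec (w ∈? xs)) ×-dec
      (T? (adjacent? v u) ×-dec T? (adjacent? v w)) ×-dec ¬? (u Fin.≟ w)

    -- Only the first length values of vertex matter.
    record PathIn (xs : List (Fin n)) (length : ℕ) : Set where
      field
        vertex   : ℕ → Fin n
        member   : ∀ {i} → i < length → vertex i ∈ xs
        distinct : ∀ {i j} → i < length → j < length → vertex i ≡ vertex j → i ≡ j
        step     : ∀ {i} → suc i < length → Adj (vertex i) (vertex (suc i))

    -- Such a chord would close the initial segment of the path, with its `3 + e` vertices, to a
    -- cycle.
    closed-path : ∀ {xs l} (p : PathIn xs l) (let open PathIn p) →
                  ∀ e → 2 + e < l → ¬ Adj (vertex 0) (vertex (2 + e))
    closed-path p e 2+e<l adj = acyclic record
      { excess   = e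
      ; vertex   = vertex ∘ toℕ
      ; distinct = λ i j → toℕ-injective ∘ distinct (bounded i) (bounded j)
      ; step     = λ i → subst (λ j → Adj (vertex j) (vertex (suc (toℕ i))))
                     (sym (toℕ-inject₁ i)) (step (≤-<-trans (toℕ<n i) 2+e<l))
      ; close    = subst (λ j → Adj (vertex j) (vertex 0))
                     (sym (toℕ-fromℕ (2 + e))) (symmetric adj)
      }
      where
      open PathIn p
      bounded : ∀ (i : Fin (3 + e)) → toℕ i < _
      bounded i = <-≤-trans (toℕ<n i) 2+e<l

    module _ {xs : List (Fin n)} (branching : ∀ {v} → v ∈ xs → TwoNeighbours xs v) where

      other-neighbour : ∀ {v} x → v ∈ xs → ∃[ z ] z ∈ xs × Adj v z × z ≢ x
      other-neighbour x v∈ with branching v∈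
      ... | u , w , (u∈ , w∈) , (vu , vw) , u≢w with u Fin.≟ x
      ...   | no u≢x   = u , u∈ , vu , u≢x
      ...   | yes refl = w , w∈ , vw , ≢-sym u≢w

      -- The path grows at its front, by a neighbour of `vertex 0` other than `vertex 1`. This
      -- neighbour is new: it is not `vertex 0`, and a later vertex would give a chord excluded by
      -- `closed-path`.
      extend : ∀ {l} → PathIn xs (2 + l) → PathIn xs (3 + l)
      extend {l} p with other-neighbour (PathIn.vertex p 1) (PathIn.member p z<s)
      ... | z , z∈ , vz , z≢v₁ = record
        { vertex   = vertex′
        ; member   = member′
        ; distinct = distinct′
        ; step     = step′
        }
        where
        open PathIn p

        fresh : ∀ {i} → i < 2 + l → z ≢ vertex i
        fresh {zero}        _   z≡ = irreflexive (sym z≡) vz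
        fresh {suc zero}    _   z≡ = z≢v₁ z≡
        fresh {suc (suc e)} e<l z≡ = closed-path p e e<l (subst (Adj (vertex 0)) z≡ vz)

        vertex′ : ℕ → Fin n
        vertex′ zero    = z
        vertex′ (suc i) = vertex i

        member′ : ∀ {i} → i < 3 + l → vertex′ i ∈ xs
        member′ {zero}  _         = z∈
        member′ {suc i} (s≤s i<l) = member i<l

        distinct′ : ∀ {i j} → i < 3 + l → j < 3 + l → vertex′ i ≡ vertex′ j → i ≡ j
        distinct′ {zero}  {zero}  _         _         _  = refl
        distinct′ {zero}  {suc j} _         (s≤s j<l) eq = contradiction eq (fresh j<l)
        distinct′ {suc i} {zero}  (s≤s i<l) _         eq = contradiction (sym eq) (fresh i<l)
        distinct′ {suc i} {suc j} (s≤s i<l) (s≤s j<l) eq = cong suc (distinct i<l j<l eq)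

        step′ : ∀ {i} → suc i < 3 + l → Adj (vertex′ i) (vertex′ (suc i))
        step′ {zero}  _         = symmetric vz
        step′ {suc i} (s≤s i<l) = step i<l

      edge-path : ∀ {v} → v ∈ xs → PathIn xs 2
      edge-path {v} v∈ with branching v∈
      ... | u , _ , (u∈ , _) , (vu , _) , _ = record
        { vertex   = λ { zero → v ; (suc _) → u }
        ; member   = λ { {zero} _ → v∈ ; {suc _} _ → u∈ }
        ; distinct = distinct
        ; step     = λ { {zero} _ → vu ; {suc _} (s≤s (s≤s ())) }
        }
        where
        distinct : ∀ {i j} → i < 2 → j < 2 → _ → i ≡ j
        distinct {zero}        {zero}        _ _ _ = refl
        distinct {zero}        {suc zero}    _ _ v≡u = contradiction vu (irreflexive v≡u)
        distinct {suc zero}    {zero}        _ _ u≡v = contradiction vu (irreflexive (sym u≡v))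
        distinct {suc zero}    {suc zero}    _ _ _ = refl
        distinct {suc (suc _)} (s≤s (s≤s ()))
        distinct {_} {suc (suc _)} _ (s≤s (s≤s ()))

      long-path : ∀ {v} → v ∈ xs → ∀ l → PathIn xs (2 + l)
      long-path v∈ zero    = edge-path v∈
      long-path v∈ (suc l) = extend (long-path v∈ l)

      -- Otherwise paths could be extended to `2 + n` distinct vertices among the `n` available.
      branching-empty : ∀ {v} → ¬ (v ∈ xs)
      branching-empty v∈ = <⇒≱ (s≤s (n≤1+n n)) (injective⇒≤ {f = vertex ∘ toℕ}
        λ {i} {j} → toℕ-injective ∘ distinct (toℕ<n i) (toℕ<n j))
        where open PathIn (long-path v∈ n)

    pendant : ∀ {x} xs → x ∈ xs → ∃[ v ] v ∈ xs × ¬ TwoNeighbours xs v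
    pendant xs x∈ with any? (λ v → (v ∈? xs) ×-dec ¬? (twoNeighbours? xs v))
    ... | yes found = found
    ... | no none = contradiction x∈ (branching-empty λ {v} v∈ →
            decidable-stable (twoNeighbours? xs v) λ ¬two → none (v , v∈ , ¬two))

    -- All levels are less than `bound`, so the value `bound` itself is free for the vertex that is
    -- added next. The same number is what the recursion of `partialOrder` descends on.
    record PartialOrder (xs : List (Fin n)) (bound : ℕ) : Set where
      field
        level           : Fin n → ℕ
        level<bound     : ∀ {v} → v ∈ xs → level v < bound
        level-injective : ∀ {u v} → u ∈ xs → v ∈ xs → level u ≡ level v → u ≡ v
        unique-lower    : ∀ {v u w} → v ∈ xs → u ∈ xs → w ∈ xs → Adj v u → Adj v w →
                          level u < level v → level w < level v → u ≡ w

    -- A vertex with at most one neighbour among xs goes last.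
    partialOrder : ∀ bound xs → length xs ≤ bound → PartialOrder xs bound
    partialOrder bound xs l≤ with any? (_∈? xs)
    ... | no empty = record
      { level           = λ _ → 0
      ; level<bound     = λ v∈ → contradiction (_ , v∈) empty
      ; level-injective = λ u∈ → contradiction (_ , u∈) empty
      ; unique-lower    = λ v∈ → contradiction (_ , v∈) empty
      }
    ... | yes (x , x∈) with pendant xs x∈
    ...   | v₀ , v₀∈ , ¬two = place bound (<-≤-trans shorter l≤)
      where
      ≢v₀? : ∀ u → Dec (u ≢ v₀)
      ≢v₀? u = ¬? (u Fin.≟ v₀)

      rest : List (Fin n)
      rest = filter ≢v₀? xs

      shorter : length rest < length xs
      shorter = filter-notAll ≢v₀? xs (lose v₀∈ λ ≢v₀ → ≢v₀ refl)

      place : ∀ b → length rest < b → PartialOrder xs b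
      place (suc b) (s≤s l≤b) = record
        { level           = level′
        ; level<bound     = level′<
        ; level-injective = level′-injective
        ; unique-lower    = unique-lower′
        }
        where
        open PartialOrder (partialOrder b rest l≤b)

        level′ : Fin n → ℕ
        level′ u with u Fin.≟ v₀
        ... | yes _ = b
        ... | no _  = level u

        last-or-rest : ∀ {u} → u ∈ xs → (u ≡ v₀ × level′ u ≡ b) ⊎
                       (u ∈ rest × level′ u ≡ level u)
        last-or-rest {u} u∈ with u Fin.≟ v₀
        ... | yes u≡v₀ = inj₁ (u≡v₀ , refl)
        ... | no u≢v₀  = inj₂ (∈-filter⁺ ≢v₀? u∈ u≢v₀ , refl)

        level′< : ∀ {v} → v ∈ xs → level′ v < suc b
        level′< v∈ with last-or-rest v∈
        ... | inj₁ (_ , l≡)  = ≤-reflexive (cong suc l≡)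
        ... | inj₂ (v∈ , l≡) = subst (_< suc b) (sym l≡) (m<n⇒m<1+n (level<bound v∈))

        lower⇒rest : ∀ {u v} → u ∈ xs → v ∈ xs → level′ u < level′ v →
                     u ∈ rest × level′ u ≡ level u
        lower⇒rest u∈ v∈ u<v with last-or-rest u∈
        ... | inj₂ u-rest   = u-rest
        ... | inj₁ (_ , l≡) = contradiction (≤-pred (level′< v∈)) (<⇒≱ (subst (_< _) l≡ u<v))

        level′-injective : ∀ {u v} → u ∈ xs → v ∈ xs → level′ u ≡ level′ v → u ≡ v
        level′-injective u∈ v∈ lu≡lv with last-or-rest u∈ | last-or-rest v∈
        ... | inj₁ (u≡ , _)  | inj₁ (v≡ , _)  = trans u≡ (sym v≡)
        ... | inj₁ (_ , u≡b) | inj₂ (v∈′ , l≡) = contradiction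
                (trans (sym l≡) (trans (sym lu≡lv) u≡b)) (<⇒≢ (level<bound v∈′))
        ... | inj₂ (u∈′ , l≡) | inj₁ (_ , v≡b) = contradiction
                (trans (sym l≡) (trans lu≡lv v≡b)) (<⇒≢ (level<bound u∈′))
        ... | inj₂ (u∈′ , u≡) | inj₂ (v∈′ , v≡) =
                level-injective u∈′ v∈′ (trans (sym u≡) (trans lu≡lv v≡))

        unique-lower′ : ∀ {v u w} → v ∈ xs → u ∈ xs → w ∈ xs → Adj v u → Adj v w →
                        level′ u < level′ v → level′ w < level′ v → u ≡ w
        unique-lower′ {v} {u} {w} v∈ u∈ w∈ vu vw u<v w<v with last-or-rest v∈
        ... | inj₁ (refl , _) = decidable-stable (u Fin.≟ w)
                λ u≢w → ¬two (u , w , (u∈ , w∈) , (vu , vw) , u≢w)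
        ... | inj₂ (v∈′ , v≡) with lower⇒rest u∈ v∈ u<v | lower⇒rest w∈ v∈ w<v
        ...   | u∈′ , u≡ | w∈′ , w≡ = unique-lower v∈′ u∈′ w∈′ vu vw
                (subst₂ _<_ u≡ v≡ u<v) (subst₂ _<_ w≡ v≡ w<v)

    treeOrder : TreeOrder
    treeOrder = record
      { level           = level
      ; level-injective = λ {u} {v} → level-injective (∈-allFin u) (∈-allFin v)
      ; unique-lower    = λ {v} {u} {w} → unique-lower (∈-allFin v) (∈-allFin u) (∈-allFin w)
      }
      where open PartialOrder (partialOrder _ (allFin n) ≤-refl)

-- Subdivided trees as typed forests

toℕ-opposite : ∀ {t} (i : Fin t) → suc (toℕ i + toℕ (opposite i)) ≡ t
toℕ-opposite i = trans (cong (suc (toℕ i) +_) (opposite-prop i)) (m+[n∸m]≡n (toℕ<n i))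

∣none∣≡0 : ∀ {n} {f : Fin n → _} → (∀ i → ¬ T (f i)) → ∣ tabulate f ∣ ≡ 0
∣none∣≡0 {zero}  none = refl
∣none∣≡0 {suc n} {f} none with f zero | none zero
... | false | _  = ∣none∣≡0 (none ∘ suc)
... | true  | ¬T = contradiction tt ¬T

no-neighbours⇒isolated : ∀ {n} (G : Graph n) (let open Graph G) {v} →
                         (∀ w → ¬ Adj v w) → Isolated v
no-neighbours⇒isolated G none = ∣none∣≡0 none

module Subdivided {n k : ℕ} (H : Graph n) (F : Graph k) (order : TreeOrder H)
                  (sub : FullSubdivision H F) where

  open Graph H
  open Edge using (low; high; low<high; adj)
  open TreeOrder order
  open FullSubdivision sub

  SV : Set
  SV = SubdivisionVertex H internal

  -- Directing the paths away from the roots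

  lowFirst? : ∀ e → Dec (level (low e) < level (high e))
  lowFirst? e = level (low e) <? level (high e)

  topBy bottomBy : ∀ e → Dec (level (low e) < level (high e)) → Fin n
  topBy e (yes _)    = low e
  topBy e (no _)     = high e
  bottomBy e (yes _) = high e
  bottomBy e (no _)  = low e

  -- Reversing the path when necessary, positions are counted from the top.
  flipBy : ∀ e → Dec (level (low e) < level (high e)) → Fin (internal e) → Fin (internal e)
  flipBy e (yes _) i = i
  flipBy e (no _)  i = opposite i

  top bottom : Edge → Fin n
  top e    = topBy e (lowFirst? e)
  bottom e = bottomBy e (lowFirst? e)

  position : ∀ e → Fin (internal e) → ℕ
  position e i = toℕ (flipBy e (lowFirst? e) i)

  position< : ∀ e i → position e i < internal e
  position< e i = toℕ<n (flipBy e (lowFirst? e) i)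

  -- Keeps the outcome of the level comparison as equations, so that it can be analysed without
  -- unfolding `top`, `bottom` and `position`.
  data Direction (e : Edge) (t b : Fin n) (p : Fin (internal e) → ℕ) : Set where
    downward : t ≡ low e → b ≡ high e → (∀ i → p i ≡ toℕ i) → Direction e t b p
    upward   : t ≡ high e → b ≡ low e → (∀ i → p i ≡ toℕ (opposite i)) → Direction e t b p

  direction : ∀ e → Direction e (top e) (bottom e) (position e)
  direction e = by (lowFirst? e)
    where
    by : ∀ d → Direction e (topBy e d) (bottomBy e d) (toℕ ∘ flipBy e d)
    by (yes _) = downward refl refl λ _ → refl
    by (no _)  = upward refl refl λ _ → refl

  top-level-< : ∀ e → level (top e) < level (bottom e)
  top-level-< e = by (lowFirst? e)
    where
    by : ∀ d → level (topBy e d) < level (bottomBy e d)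
    by (yes low<) = low<
    by (no low≮)  = ≤∧≢⇒< (≮⇒≥ low≮) λ high≡low →
      irreflexive (sym (level-injective high≡low)) (adj e)

  bottom-adj-top : ∀ e → Adj (bottom e) (top e)
  bottom-adj-top e with direction e
  ... | downward t b _ = subst₂ Adj (sym b) (sym t) (symmetric (adj e))
  ... | upward t b _   = subst₂ Adj (sym b) (sym t) (adj e)

  at : ∀ e {p} → p < internal e → ∃[ i ] position e i ≡ p
  at e {p} p< = by (lowFirst? e)
    where
    by : ∀ d → ∃[ i ] toℕ (flipBy e d i) ≡ p
    by (yes _) = fromℕ< p< , toℕ-fromℕ< p<
    by (no _)  = opposite (fromℕ< p<) ,
                 trans (cong toℕ (opposite-involutive (fromℕ< p<))) (toℕ-fromℕ< p<)

  position-injective : ∀ e {i j} → position e i ≡ position e j → i ≡ j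
  position-injective e {i} {j} pi≡pj with direction e
  ... | downward _ _ p = toℕ-injective (trans (sym (p i)) (trans pi≡pj (p j)))
  ... | upward _ _ p = begin
    i                     ≡⟨ opposite-involutive i ⟨
    opposite (opposite i) ≡⟨ cong opposite (toℕ-injective (trans (sym (p i)) (trans pi≡pj (p j)))) ⟩
    opposite (opposite j) ≡⟨ opposite-involutive j ⟩
    j                     ∎
    where open ≡-Reasoning

  edge-≡ : ∀ {e e′} → low e ≡ low e′ → high e ≡ high e′ → e ≡ e′
  edge-≡ {edge l<h lh} {edge l<h′ lh′} refl refl =
    cong₂ edge (<-irrelevant l<h l<h′) (T-irrelevant lh lh′)

  -- Both tops are lower neighbours of the common bottom, so `unique-lower` identifies them. Edges
  -- with the same ends, each listed in increasing order, coincide.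
  edge-unique : ∀ {e e′} → bottom e ≡ bottom e′ → e ≡ e′
  edge-unique {e} {e′} b≡b′ = by (direction e) (direction e′)
    where
    t≡t′ : top e ≡ top e′
    t≡t′ = unique-lower (bottom-adj-top e)
      (subst (λ b → Adj b (top e′)) (sym b≡b′) (bottom-adj-top e′))
      (top-level-< e) (subst (λ b → level (top e′) < level b) (sym b≡b′) (top-level-< e′))
    by : Direction e (top e) (bottom e) (position e) →
         Direction e′ (top e′) (bottom e′) (position e′) → e ≡ e′
    by (downward t b _) (downward t′ b′ _) =
      edge-≡ (trans (sym t) (trans t≡t′ t′)) (trans (sym b) (trans b≡b′ b′))
    by (upward t b _) (upward t′ b′ _) =
      edge-≡ (trans (sym b) (trans b≡b′ b′)) (trans (sym t) (trans t≡t′ t′))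
    by (downward t b _) (upward t′ b′ _) = contradiction (low<high e′)
      (<-asym (subst₂ Fin._<_ (trans (sym t) (trans t≡t′ t′))
                              (trans (sym b) (trans b≡b′ b′))
                              (low<high e)))
    by (upward t b _) (downward t′ b′ _) = contradiction (low<high e′)
      (<-asym (subst₂ Fin._<_ (trans (sym b) (trans b≡b′ b′))
                              (trans (sym t) (trans t≡t′ t′))
                              (low<high e)))

  edge-to : ∀ {v u} → Adj v u → level u < level v → ∃[ e ] bottom e ≡ v × top e ≡ u
  edge-to {v} {u} vu u<v with Fin.<-cmp v u
  ... | tri≈ _ v≡u _ = contradiction vu (irreflexive v≡u)
  ... | tri< v<u _ _ = e , by (lowFirst? e)
    where
    e : Edge
    e = edge v<u vu
    by : ∀ d → bottomBy e d ≡ v × topBy e d ≡ u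
    by (yes v<u′) = contradiction v<u′ (<-asym u<v)
    by (no _)     = refl , refl
  ... | tri> _ _ u<v′ = e , by (lowFirst? e)
    where
    e : Edge
    e = edge u<v′ (symmetric vu)
    by : ∀ d → bottomBy e d ≡ v × topBy e d ≡ u
    by (yes _)  = refl , refl
    by (no u≮v) = contradiction u<v u≮v

  -- The parent relation on subdivision vertices

  data Up : SV → SV → Set where
    first : ∀ {e i v} → top e ≡ v → position e i ≡ 0 → Up (inj₂ (e , i)) (inj₁ v)
    next  : ∀ {e i j} → position e j ≡ suc (position e i) → Up (inj₂ (e , j)) (inj₂ (e , i))
    last  : ∀ {e i v} → bottom e ≡ v → suc (position e i) ≡ internal e →
            Up (inj₁ v) (inj₂ (e , i))

  opposite-first : ∀ {t} {i : Fin t} → toℕ i ≡ 0 → suc (toℕ (opposite i)) ≡ t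
  opposite-first {i = i} i≡0 = subst (λ x → suc (x + toℕ (opposite i)) ≡ _) i≡0 (toℕ-opposite i)

  opposite-last : ∀ {t} {i : Fin t} → suc (toℕ i) ≡ t → toℕ (opposite i) ≡ 0
  opposite-last {i = i} i≡t = +-cancelˡ-≡ (suc (toℕ i)) _ _
    (trans (toℕ-opposite i) (trans (sym i≡t) (sym (+-identityʳ _))))

  opposite-next : ∀ {t} {i j : Fin t} → toℕ j ≡ suc (toℕ i) →
                  toℕ (opposite i) ≡ suc (toℕ (opposite j))
  opposite-next {t} {i} {j} j≡ = +-cancelˡ-≡ (suc (toℕ i)) _ _ (begin
    suc (toℕ i) + toℕ (opposite i)       ≡⟨ toℕ-opposite i ⟩
    t                                    ≡⟨ toℕ-opposite j ⟨
    suc (toℕ j + toℕ (opposite j))       ≡⟨ cong (λ x → suc (x + toℕ (opposite j))) j≡ ⟩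
    suc (suc (toℕ i) + toℕ (opposite j)) ≡⟨ +-suc (suc (toℕ i)) _ ⟨
    suc (toℕ i) + suc (toℕ (opposite j)) ∎)
    where open ≡-Reasoning

  -- On a downward edge `Consecutive` runs from parent to child. On an upward edge it runs from
  -- child to parent, and `opposite` exchanges the first and last positions.
  consecutive⇒up : ∀ {s p} → Consecutive H internal s p → SymClosure Up s p
  consecutive⇒up (enter e i i≡0) with direction e
  ... | downward t _ p = bwd (first t (trans (p i) i≡0))
  ... | upward _ b p   = fwd (last b (trans (cong suc (p i)) (opposite-first i≡0)))
  consecutive⇒up (along e i j j≡) with direction e
  ... | downward _ _ p = bwd (next (trans (p j) (trans j≡ (cong suc (sym (p i))))))
  ... | upward _ _ p   = fwd (next (trans (p i) (trans (opposite-next j≡) (cong suc (sym (p j))))))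
  consecutive⇒up (leave e i i≡) with direction e
  ... | downward _ b p = bwd (last b (trans (cong suc (p i)) i≡))
  ... | upward t _ p   = fwd (first t (trans (p i) (opposite-last i≡)))

  up⇒consecutive : ∀ {s p} → Up s p → SymClosure (Consecutive H internal) s p
  up⇒consecutive (first {e} {i} refl p≡0) with direction e
  ... | downward t _ p = subst (λ v → SymClosure _ _ (inj₁ v)) (sym t)
          (bwd (enter e i (trans (sym (p i)) p≡0)))
  ... | upward t _ p = subst (λ v → SymClosure _ _ (inj₁ v)) (sym t)
          (fwd (leave e i (subst (λ j → suc (toℕ j) ≡ internal e) (opposite-involutive i)
            (opposite-first (trans (sym (p i)) p≡0)))))
  up⇒consecutive (next {e} {i} {j} pj≡) with direction e
  ... | downward _ _ p = bwd (along e i j (trans (sym (p j)) (trans pj≡ (cong suc (p i)))))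
  ... | upward _ _ p = fwd (along e j i
          (subst₂ (λ x y → toℕ x ≡ suc (toℕ y)) (opposite-involutive i) (opposite-involutive j)
            (opposite-next (trans (sym (p j)) (trans pj≡ (cong suc (p i)))))))
  up⇒consecutive (last {e} {i} refl p≡) with direction e
  ... | downward _ b p = subst (λ v → SymClosure _ (inj₁ v) _) (sym b)
          (bwd (leave e i (trans (cong suc (sym (p i))) p≡)))
  ... | upward _ b p = subst (λ v → SymClosure _ (inj₁ v) _) (sym b)
          (fwd (enter e i (subst (λ j → toℕ j ≡ 0) (opposite-involutive i)
            (opposite-last (trans (cong suc (sym (p i))) p≡)))))

  up-functional : ∀ {s p q} → Up s p → Up s q → p ≡ q
  up-functional (first refl _) (first refl _) = refl
  up-functional (first _ p≡0)  (next p≡s)     = contradiction (trans (sym p≡0) p≡s) λ ()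
  up-functional (next p≡s)     (first _ p≡0)  = contradiction (trans (sym p≡0) p≡s) λ ()
  up-functional (next {e} p≡)  (next p≡′)     =
    cong (λ i → inj₂ (e , i)) (position-injective e (suc-injective (trans (sym p≡) p≡′)))
  -- An original vertex is the bottom of only one edge.
  up-functional (last {e} b≡ p≡) (last {e′} b≡′ p≡′) with edge-unique {e} {e′} (trans b≡ (sym b≡′))
  ... | refl = cong (λ i → inj₂ (e , i)) (position-injective e (suc-injective (trans p≡ (sym p≡′))))

  only-child : ∀ {s s′ e i} → Up s (inj₂ (e , i)) → Up s′ (inj₂ (e , i)) → s ≡ s′
  only-child (last refl _)   (last refl _)  = refl
  only-child (next {e} p≡)   (next p≡′)     =
    cong (λ i → inj₂ (e , i)) (position-injective e (trans p≡ (sym p≡′)))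
  only-child (next {e} {_} {j} p≡) (last _ p≡′) =
    contradiction (trans p≡ p≡′) (<⇒≢ (position< e j))
  only-child (last _ p≡′) (next {e} {_} {j} p≡) =
    contradiction (trans p≡ p≡′) (<⇒≢ (position< e j))

  -- Kinds of subdivision vertices

  parentEdge? : ∀ v → Dec (∃[ e ] bottom e ≡ v)
  parentEdge? v with any? (λ u → T? (adjacent? v u) ×-dec (level u <? level v))
  ... | yes (u , vu , u<v) = yes (proj₁ (edge-to vu u<v) , proj₁ (proj₂ (edge-to vu u<v)))
  ... | no none = no λ { (e , refl) → none (top e , bottom-adj-top e , top-level-< e) }

  -- The argument is the kind of an internal vertex; the value is that of the next internal vertex,
  -- or of the lower end of the path. They differ after a below vertex: an original vertex may have
  -- many children and so must not become a link.
  afterLink afterLast : Kind → Kind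
  afterLink link = below
  afterLink _    = link
  afterLast link = below
  afterLast _    = direct

  kindAt : ℕ → Kind
  kindAt zero    = link
  kindAt (suc p) = afterLink (kindAt p)

  kindBy : ∀ {v} → Dec (∃[ e ] bottom e ≡ v) → Kind
  -- The last internal vertex has position `pred (internal e)`, as `internal e` is positive.
  kindBy (yes (e , _)) = afterLast (kindAt (pred (internal e)))
  kindBy (no _)        = root

  kindOf : SV → Kind
  kindOf (inj₁ v)       = kindBy (parentEdge? v)
  kindOf (inj₂ (e , i)) = kindAt (position e i)

  kindAt-link-or-below : ∀ p → kindAt p ≡ link ⊎ kindAt p ≡ below
  kindAt-link-or-below zero = inj₁ refl
  kindAt-link-or-below (suc p) with kindAt p
  ... | root   = inj₁ refl
  ... | below  = inj₁ refl
  ... | direct = inj₁ refl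
  ... | link   = inj₂ refl

  kindAt≢root : ∀ p → kindAt p ≢ root
  kindAt≢root p r with kindAt-link-or-below p
  ... | inj₁ l with () ← trans (sym l) r
  ... | inj₂ b with () ← trans (sym b) r

  -- The kinds of a child and its parent, in this order, for the first, a later and the lower end
  -- vertex of a path.
  data KindStep : Kind → Kind → Set where
    top-step   : ∀ {c} → KindStep link c
    inner-step : ∀ {c} → c ≡ link ⊎ c ≡ below → KindStep (afterLink c) c
    last-step  : ∀ {c} → c ≡ link ⊎ c ≡ below → KindStep (afterLast c) c

  kind-last : ∀ e → kindOf (inj₁ (bottom e)) ≡ afterLast (kindAt (pred (internal e)))
  kind-last e = by (parentEdge? (bottom e))
    where
    by : (d : Dec (∃[ e′ ] bottom e′ ≡ bottom e)) →
         kindBy d ≡ afterLast (kindAt (pred (internal e)))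
    by (yes (e′ , b)) = cong (λ x → afterLast (kindAt (pred (internal x)))) (edge-unique b)
    by (no none)      = contradiction (e , refl) none

  kind-step : ∀ {s p} → Up s p → KindStep (kindOf s) (kindOf p)
  kind-step (first _ p≡0) rewrite p≡0 = top-step
  kind-step (next {e} {i} p≡) rewrite p≡ = inner-step (kindAt-link-or-below (position e i))
  kind-step (last {e} {i} refl p≡) = subst (λ c → KindStep c (kindAt (position e i)))
    (sym (trans (kind-last e) (cong (λ t → afterLast (kindAt (pred t))) (sym p≡))))
    (last-step (kindAt-link-or-below (position e i)))

  kind-vertex≢link : ∀ v → kindOf (inj₁ v) ≢ link
  kind-vertex≢link v = by (parentEdge? v)
    where
    afterLast≢link : ∀ c → afterLast c ≢ link
    afterLast≢link root   ()
    afterLast≢link below  ()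
    afterLast≢link direct ()
    afterLast≢link link   ()
    by : (d : Dec (∃[ e ] bottom e ≡ v)) → kindBy d ≢ link
    by (yes (e , _)) = afterLast≢link (kindAt (pred (internal e)))
    by (no _)        = λ ()

  up⇒nonroot : ∀ {s p} → Up s p → kindOf s ≢ root
  up⇒nonroot u r with subst (λ c → KindStep c _) r (kind-step u)
  ... | step = impossible refl step
    where
    impossible : ∀ {c d} → c ≡ root → ¬ KindStep c d
    impossible () top-step
    impossible () (inner-step (inj₁ refl))
    impossible () (inner-step (inj₂ refl))
    impossible () (last-step (inj₁ refl))
    impossible () (last-step (inj₂ refl))

  link-step : ∀ {s p} → Up s p → kindOf s ≡ link → kindOf p ≢ link
  link-step (first {v = v} _ _) _ = kind-vertex≢link v
  link-step (next p≡) s-link p-link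
    with () ← trans (sym s-link) (trans (cong kindAt p≡) (cong afterLink p-link))
  link-step (last {v = v} _ _) v-link = contradiction v-link (kind-vertex≢link v)

  below-step : ∀ {s p} → Up s p → kindOf s ≡ below → kindOf p ≡ link
  below-step u b = by b (kind-step u)
    where
    by : ∀ {c d} → c ≡ below → KindStep c d → d ≡ link
    by () top-step
    by _  (inner-step (inj₁ refl)) = refl
    by () (inner-step (inj₂ refl))
    by _  (last-step (inj₁ refl)) = refl
    by () (last-step (inj₂ refl))

  direct-step : ∀ {s p} → Up s p → kindOf s ≡ direct → kindOf p ≡ below
  direct-step u d = by d (kind-step u)
    where
    by : ∀ {c d} → c ≡ direct → KindStep c d → d ≡ below
    by () top-step
    by () (inner-step (inj₁ refl))
    by () (inner-step (inj₂ refl))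
    by () (last-step (inj₁ refl))
    by _  (last-step (inj₂ refl)) = refl

  -- A child of an original vertex has position 0 and is a link. Every other parent is internal to a
  -- path and has a single child.
  nonlink-only-child : ∀ {s s′ p} → Up s p → Up s′ p → kindOf s ≢ link → s′ ≡ s
  nonlink-only-child (first _ p≡0) _ ¬l = contradiction (cong kindAt p≡0) ¬l
  nonlink-only-child u@(next _)    u′ _ = only-child u′ u
  nonlink-only-child u@(last _ _)  u′ _ = only-child u′ u

  link-has-below : ∀ s → kindOf s ≡ link → ∃[ c ] kindOf c ≡ below × Up c s
  link-has-below (inj₁ v) v-link = contradiction v-link (kind-vertex≢link v)
  link-has-below (inj₂ (e , i)) l with m≤n⇒m<n∨m≡n (position< e i)
  ... | inj₁ p< with at e p<
  ...   | j , pj≡ = inj₂ (e , j) , trans (cong kindAt pj≡) (cong afterLink l) , next pj≡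
  link-has-below (inj₂ (e , i)) l | inj₂ p≡ = inj₁ (bottom e) ,
    trans (kind-last e)
      (trans (cong (λ t → afterLast (kindAt (pred t))) (sym p≡)) (cong afterLast l)) ,
    last refl p≡

  lastPosition : ∀ e → ∃[ i ] suc (position e i) ≡ internal e
  lastPosition e = proj₁ found , trans (cong suc (proj₂ found)) suc-pred≡
    where
    suc-pred≡ : suc (pred (internal e)) ≡ internal e
    suc-pred≡ = suc-pred (internal e) {{>-nonZero (internal≥1 e)}}
    found : ∃[ i ] position e i ≡ pred (internal e)
    found = at e (≤-reflexive suc-pred≡)

  nonroot⇒up : ∀ s → kindOf s ≢ root → ∃[ p ] Up s p
  nonroot⇒up (inj₂ (e , i)) _ = by (position e i) refl
    where
    by : ∀ q → position e i ≡ q → ∃[ p ] Up (inj₂ (e , i)) p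
    by zero    p≡0 = inj₁ (top e) , first refl p≡0
    by (suc q) p≡  with at e (<-trans (n<1+n q) (subst (_< internal e) p≡ (position< e i)))
    ... | j , pj≡q = inj₂ (e , j) , next (trans p≡ (cong suc (sym pj≡q)))
  nonroot⇒up (inj₁ v) ¬root = by (parentEdge? v) ¬root
    where
    by : (d : Dec (∃[ e ] bottom e ≡ v)) → kindBy d ≢ root → ∃[ p ] Up (inj₁ v) p
    by (no _) ¬r = contradiction refl ¬r
    by (yes (e , b)) _ = inj₂ (e , proj₁ (lastPosition e)) , last b (proj₂ (lastPosition e))

  parentBy : ∀ s → Dec (kindOf s ≢ root) → SV
  parentBy s (yes ¬r) = proj₁ (nonroot⇒up s ¬r)
  parentBy s (no _)   = s

  parentOf : SV → SV
  parentOf s = parentBy s (¬? (kindOf s ≟ᴷ root))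

  up-parentOf : ∀ s → kindOf s ≢ root → Up s (parentOf s)
  up-parentOf s ¬root = by (¬? (kindOf s ≟ᴷ root))
    where
    by : (d : Dec (kindOf s ≢ root)) → Up s (parentBy s d)
    by (yes ¬r) = proj₂ (nonroot⇒up s ¬r)
    by (no r)   = contradiction ¬root r

  -- Depths of subdivision vertices

  pathLengthBy : ∀ {v} → Dec (∃[ e ] bottom e ≡ v) → ℕ
  pathLengthBy (yes (e , _)) = internal e
  pathLengthBy (no _)        = 0

  -- Each edge is the parent edge of its bottom, so the sum over the vertices covers every path
  -- length.
  width : ℕ
  width = suc (sum (λ v → pathLengthBy (parentEdge? v)))

  internal<width : ∀ e → internal e < width
  internal<width e = s≤s (≤-trans (≤-reflexive (sym (by (parentEdge? (bottom e)))))
    (term≤sum (λ v → pathLengthBy (parentEdge? v)) (bottom e)))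
    where
    by : (d : Dec (∃[ e′ ] bottom e′ ≡ bottom e)) → pathLengthBy d ≡ internal e
    by (yes (_ , b)) = cong internal (edge-unique b)
    by (no none)     = contradiction (e , refl) none

  -- Levels are spread out by `width`, which leaves room for a whole path between the levels of its
  -- ends.
  depthOf : SV → ℕ
  depthOf (inj₁ v)       = level v * width
  depthOf (inj₂ (e , i)) = level (top e) * width + suc (position e i)

  up-depth : ∀ {s p} → Up s p → depthOf p < depthOf s
  up-depth (first {e} refl p≡0) = m<m+n (level (top e) * width) z<s
  up-depth (next {e} p≡) = +-monoʳ-< (level (top e) * width) (s≤s (≤-reflexive (sym p≡)))
  up-depth (last {e} {i} refl p≡) = begin-strict
    level (top e) * width + suc (position e i)
      ≡⟨ cong (level (top e) * width +_) p≡ ⟩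
    level (top e) * width + internal e
      <⟨ +-monoʳ-< (level (top e) * width) (internal<width e) ⟩
    level (top e) * width + width
      ≡⟨ +-comm (level (top e) * width) width ⟩
    suc (level (top e)) * width
      ≤⟨ *-monoˡ-≤ width (top-level-< e) ⟩
    level (bottom e) * width ∎
    where open ≤-Reasoning

  -- A neighbour of lower level would give `v` a parent. One of higher level would give it a child,
  -- namely the vertex at position 0 of the path, which exists since every edge is subdivided.
  childless-root⇒isolated : ∀ {v} → kindOf (inj₁ v) ≡ root → (∀ s → ¬ Up s (inj₁ v)) → Isolated v
  childless-root⇒isolated {v} v-root childless = no-neighbours⇒isolated H none
    where
    none : ∀ w → ¬ Adj v w
    none w vw with <-cmp (level v) (level w)
    ... | tri≈ _ v≡w _ = irreflexive (level-injective v≡w) vw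
    ... | tri> _ _ w<v with edge-to vw w<v
    ...   | e , b , _ = up⇒nonroot (last b (proj₂ (lastPosition e))) v-root
    none w vw | tri< v<w _ _ with edge-to (symmetric vw) v<w
    ... | e , _ , refl with at e (internal≥1 e)
    ...   | i , p≡0 = childless _ (first {e} {i} refl p≡0)

  -- Transfer to the vertices of `F`

  open Bijection vertices using (to; injective) renaming (to⁻ to from)

  to∘from : ∀ s → to (from s) ≡ s
  to∘from s = proj₂ (Bijection.surjective vertices s) refl

  parentF : Fin k → Fin k
  parentF x = from (parentOf (to x))

  ChildF : Fin k → Fin k → Set
  ChildF x y = kindOf (to x) ≢ root × parentF x ≡ y

  up-parentF : ∀ {x} → kindOf (to x) ≢ root → Up (to x) (to (parentF x))
  up-parentF {x} ¬root = subst (Up (to x)) (sym (to∘from (parentOf (to x))))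
                             (up-parentOf (to x) ¬root)

  child⇒up : ∀ {x y} → ChildF x y → Up (to x) (to y)
  child⇒up (¬root , refl) = up-parentF ¬root

  up⇒child : ∀ {x y} → Up (to x) (to y) → ChildF x y
  up⇒child u = up⇒nonroot u , injective (up-functional (up-parentF (up⇒nonroot u)) u)

  adjacent⇔child : ∀ x y → Graph.Adj F x y ⇔ (ChildF x y ⊎ ChildF y x)
  adjacent⇔child x y = mk⇔
    (child ∘ Equivalence.to (adjacency x y))
    (Equivalence.from (adjacency x y) ∘
      [ consecutive , Symmetric.symmetric (Consecutive H internal) ∘ consecutive ]′)
    where
    consecutive : ∀ {x y} → ChildF x y → SymClosure (Consecutive H internal) (to x) (to y)
    consecutive = up⇒consecutive ∘ child⇒up
    closure : ∀ {x y} → SymClosure Up (to x) (to y) → ChildF x y ⊎ ChildF y x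
    closure (fwd u) = inj₁ (up⇒child u)
    closure (bwd u) = inj₂ (up⇒child u)
    child : SymClosure (Consecutive H internal) (to x) (to y) → ChildF x y ⊎ ChildF y x
    child (fwd c) = closure (consecutive⇒up c)
    child (bwd c) = swap (closure (consecutive⇒up c))

  module _ (one-isolated : AtMostOneIsolatedVertex) where

    childless-root-unique : ∀ {s s′} → kindOf s ≡ root → kindOf s′ ≡ root →
      (∀ c → ¬ Up c s) → (∀ c → ¬ Up c s′) → s ≡ s′
    childless-root-unique {inj₁ v} {inj₁ w} r r′ none none′ = cong inj₁
      (one-isolated v w (childless-root⇒isolated r none) (childless-root⇒isolated r′ none′))
    childless-root-unique {inj₂ (e , i)} r _ _ _ = contradiction r (kindAt≢root (position e i))
    childless-root-unique {inj₁ _} {inj₂ (e , i)} _ r _ _ =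
      contradiction r (kindAt≢root (position e i))

    typedForest : TypedForest k
    typedForest = record
      { kind               = kindOf ∘ to
      ; parent             = parentF
      ; depth              = depthOf ∘ to
      ; depth-parent       = up-depth ∘ up-parentF
      ; link-parent        = λ {v} l → link-step (up-parentF (nonroot {to v} l λ ())) l
      ; link-child         = link-child
      ; below-parent       = λ {v} b → below-step (up-parentF (nonroot {to v} b λ ())) b
      ; below-only-child   = λ b → only b (λ ()) (λ ())
      ; direct-parent      = λ {v} d → direct-step (up-parentF (nonroot {to v} d λ ())) d
      ; direct-only-child  = λ d → only d (λ ()) (λ ())
      ; one-childless-root = λ r s none none′ → injective
          (childless-root-unique r s (childless none) (childless none′))
      }
      where
      nonroot : ∀ {s c} → kindOf s ≡ c → c ≢ root → kindOf s ≢ root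
      nonroot refl c≢root = c≢root

      link-child : ∀ {x} → kindOf (to x) ≡ link → ∃[ c ] kindOf (to c) ≡ below × parentF c ≡ x
      link-child {x} l with link-has-below (to x) l
      ... | c , c-below , up = from c ,
        trans (cong kindOf (to∘from c)) c-below ,
        proj₂ (up⇒child (subst (λ s → Up s (to x)) (sym (to∘from c)) up))

      only : ∀ {x y c} → kindOf (to y) ≡ c → c ≢ root → c ≢ link → ChildF x (parentF y) → x ≡ y
      only refl ¬root ¬link child =
        injective (nonlink-only-child (up-parentF ¬root) (child⇒up child) ¬link)

      childless : ∀ {x} → (∀ y → ¬ ChildF y x) → ∀ s → ¬ Up s (to x)
      childless {x} none s up = none (from s)
        (up⇒child (subst (λ s → Up s (to x)) (sym (to∘from s)) up))

corollary1p3 : ∀ {n k : ℕ} (H : Graph n) (F : Graph k) →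
    Graph.Forest H → Graph.AtMostOneIsolatedVertex H →
    FullSubdivision H F →
    AdmitsAntimagicOrientation F
corollary1p3 H F forest one-isolated sub =
  typedForest⇒antimagic (typedForest one-isolated) F adjacent⇔child
  where open Subdivided H F (treeOrder H forest) sub
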